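{- Let $0<\delta<1/2$ be a constant. There is a constant $C$, depending only on $\delta$, such that the following holds. Let $k=k(n)$ be any sequence of positive integers with $k(n)=o(n^{1/3})$ as $n\to\infty$. Then for all sufficiently large $n$ and every integer $m$ with $\delta n^2\le m\le(1-\delta)n^2$, $$\mathbb E[X_{n,m}^k]\le C^k\,(\mathbb E[X_{n,m}])^k,$$ where $X_{n,m}$ is the number of perfect matchings in $B(n,m)$.
   Context: $B(n,m)$ is the random bipartite graph chosen uniformly at random from the set of all bipartite graphs with two fixed (labeled) vertex classes of size $n$ each and exactly $m$ edges. -}

module Defs where

open import Algebra.Bundles using (CommutativeRing)
open import Data.Fin using (Fin; combine)
open import Data.Fin.Properties using (any?; all?; _≟_)
open import Data.Fin.Subset using (Subset; inside; outside; _∈_; _⊆_; ∣_∣)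
open import Data.Fin.Subset.Properties using (_∈?_; _⊆?_)
open import Data.Integer using (+_)
open import Data.List using (List; []; _∷_; _++_; map; filter; length)
open import Data.Nat as ℕ using (ℕ; zero; suc)
open import Data.Nat.ListAction using (sum)
open import Data.Product using (_×_; _,_; ∃; ∃!; ∃-syntax)
open import Data.Rational using (ℚ; 0ℚ; 1ℚ; _/_; _<_; _≤_; _*_; _-_)
open import Data.Rational.Properties using (+-*-commutativeRing)
open import Data.Sum using (_⊎_)
open import Data.Vec using ([]; _∷_)
open import Function using (_⇔_)
open import Relation.Binary.PropositionalEquality using (_≡_)
open import Relation.Nullary using (¬_; Dec)
open import Relation.Nullary.Decidable using (_×-dec_; _→-dec_; map′)
open import Relation.Unary using (Decidable)
open import Algebra.Properties.Semiring.Exp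
  (CommutativeRing.semiring +-*-commutativeRing) public using (_^_)

fromℕ : ℕ → ℚ
fromℕ a = + a / 1

-- Dedekind reals: Lower q means q < x, and Upper q means x < q.
record ℝ : Set₁ where
  field
    Lower Upper     : ℚ → Set
    lower-inhabited : ∃ Lower
    upper-inhabited : ∃ Upper
    lower-rounded   : ∀ q → Lower q ⇔ (∃[ r ] (q < r × Lower r))
    upper-rounded   : ∀ q → Upper q ⇔ (∃[ r ] (r < q × Upper r))
    disjoint        : ∀ q → ¬ (Lower q × Upper q)
    located         : ∀ q r → q < r → Lower q ⊎ Upper r

infix 4 _<ʳ_ _ʳ<_

_<ʳ_ : ℚ → ℝ → Set
q <ʳ x = ℝ.Lower x q

_ʳ<_ : ℝ → ℚ → Set
x ʳ< q = ℝ.Upper x q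

-- δ n² ≤ m ≤ (1 - δ) n² for real δ.  As n² ≥ 0, each inequality holds for δ
-- exactly when it holds for every rational q < δ.
DensityRange : ℝ → ℕ → ℕ → Set
DensityRange δ n m = ∀ q → q <ʳ δ →
  q * fromℕ (n ℕ.* n) ≤ fromℕ m ×
  fromℕ m ≤ (1ℚ - q) * fromℕ (n ℕ.* n)

-- k(n) = o(n^{1/3}): for each ε > 0, eventually k(n) ≤ ε n^{1/3}; both sides
-- are cubed, since n^{1/3} need not be rational.
IsLittleOCbrt : (ℕ → ℕ) → Set
IsLittleOCbrt k = ∀ ε → 0ℚ < ε →
  ∃[ N ] (∀ n → N ℕ.≤ n → fromℕ (k n) ^ 3 ≤ ε ^ 3 * fromℕ n)

-- A bipartite graph on two labelled classes Fin n is its edge set, where the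
-- pair (i , j) is encoded as combine i j (a bijection onto Fin (n * n)).
BipGraph : ℕ → Set
BipGraph n = Subset (n ℕ.* n)

Adj : ∀ n → BipGraph n → Fin n → Fin n → Set
Adj n G i j = combine i j ∈ G

-- The edge set M covers every vertex of both classes exactly once.
IsPerfectMatching : ∀ n → BipGraph n → Set
IsPerfectMatching n M =
  (∀ (i : Fin n) → ∃! _≡_ λ j → Adj n M i j) ×
  (∀ (j : Fin n) → ∃! _≡_ λ i → Adj n M i j)

∃!? : ∀ {n} {P : Fin n → Set} → Decidable P → Dec (∃! _≡_ P)
∃!? P? =
  map′ (λ { (i , p , u) → i , p , λ {j} → u j })
       (λ { (i , p , u) → i , p , λ j → u {j} })
       (any? λ i → P? i ×-dec all? λ j → P? j →-dec (i ≟ j))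

isPerfectMatching? : ∀ n → Decidable (IsPerfectMatching n)
isPerfectMatching? n M =
  all? (λ (i : Fin n) → ∃!? λ (j : Fin n) → combine i j ∈? M) ×-dec
  all? (λ (j : Fin n) → ∃!? λ (i : Fin n) → combine i j ∈? M)

allSubsets : ∀ n → List (Subset n)
allSubsets zero    = [] ∷ []
allSubsets (suc n) =
  map (outside ∷_) (allSubsets n) ++ map (inside ∷_) (allSubsets n)

-- The sample space of B(n,m); each graph is listed exactly once.
graphs : ∀ n → ℕ → List (BipGraph n)
graphs n m = filter (λ G → ∣ G ∣ ℕ.≟ m) (allSubsets (n ℕ.* n))

#perfectMatchings : ∀ n → BipGraph n → ℕ
#perfectMatchings n G =
  length (filter (λ M → isPerfectMatching? n M ×-dec M ⊆? G)
                 (allSubsets (n ℕ.* n)))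

-- Expectation under the uniform distribution on the entries of a list, with
-- the junk value 0 for the empty list.
𝔼 : {A : Set} → List A → (A → ℕ) → ℚ
𝔼 []           f = 0ℚ
𝔼 xs@(_ ∷ _) f = + sum (map f xs) / length xs

𝔼B : ∀ n m → (BipGraph n → ℕ) → ℚ
𝔼B n m = 𝔼 (graphs n m)

{-# OPTIONS --safe #-}
module Submission where

-- Let N = n² and let U be a graph with u ≤ kn edges.  Conditioned on U ⊆ G, the expected number of
-- perfect matchings of G is at most perm(A) for the matrix A with entry 1 on U and (m - u) / (N - u)
-- off U.  Expanding perm(A) by the set of rows in which an edge of U is used, and applying
-- Maclaurin's inequality to the row degrees of U, bounds perm(A) by n! Σⱼ p'ⁿ⁻ʲ zʲ / j!, where
-- p' = (m - u) / (N - u) and p' + z / n = m / N.  This truncated exponential sum is at most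
-- 2 n! (p' + z / n)ⁿ = 2 n! (m / N)ⁿ as soon as u² n is small against m², and n! (m / N)ⁿ is at most
-- a constant times E[X].  Hence each of the k matchings in X ^ k, added to the union of the previous
-- ones, contributes a factor O(E[X]).  All of this is carried out in ℕ with cleared denominators.

-- The delicate point is that each step may lose only a constant factor. When u is of order kn, the
-- edges of U that a matching reuses contribute an exponential in z / p', which can be of order k,
-- while p'ⁿ falls below (m / N)ⁿ by an exponential of the same order. Estimating the two separately
-- would cost a factor exponential in k per step, hence exponential in k² in all. They are therefore
-- kept together until p' + z / n = m / N cancels them. If U has row degrees dᵢ and the matrix has
-- entries P off U and P + Q on U, the bound on the permanent is Σⱼ eⱼ(Q d₁, ..., Q dₙ) Pⁿ⁻ʲ (n -
-- j)!, with eⱼ the elementary symmetric functions. This is the product of the commuting operators P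
-- E + Q dᵢ, E being the shift, applied to t ↦ t! and evaluated at 0. So no sum over j is written:
-- Maclaurin's inequality and the estimate of the truncated exponential become inequalities between
-- products of operators, proved by induction on the number of factors.

module Counting where
  open import Defs using (BipGraph; Adj; IsPerfectMatching; isPerfectMatching?; allSubsets; graphs; #perfectMatchings)
  open import Data.Bool using (if_then_else_; true; false)
  open import Data.Fin using (Fin; zero; suc; combine)
  open import Data.Fin.Properties using (combine-surjective)
  open import Data.Fin.Subset using (Subset; inside; outside; ∣_∣; ∁; _⊆_; _∪_; ⊥; ⁅_⁆)
  open import Data.Fin.Subset.Properties
    using (_⊆?_; drop-∷-⊆; out⊆; in⊆in; ⊥⊆; ⊆-antisym; x∈⁅x⁆; x∈⁅y⁆⇒x≡y; p⊆p∪q; q⊆p∪q; x∈p∪q⁻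
          ; ∣∁p∣≡n∸∣p∣; ∣p∣≤n; ∣⁅x⁆∣≡1; ∣⊥∣≡0; ∪-identityˡ; ∪-identityʳ)
  open import Data.List using (List; []; _∷_; _++_; length; map; filter; concatMap; replicate; tabulate; allFin)
  open import Data.List.Properties using (map-++; map-∘; length-map; length-tabulate; map-tabulate; ++-identityʳ)
  open import Data.List.Membership.Propositional using (_∈_)
  open import Data.List.Membership.Propositional.Properties
    using (∈-map⁺; ∈-map⁻; ∈-filter⁺; ∈-filter⁻; ∈-++⁺ˡ; ∈-++⁺ʳ; ∈-concat⁺′; ∈-concat⁻′; ∈-allFin)
  open import Data.List.Membership.Propositional.Properties.WithK using (unique∧set⇒bag)
  open import Data.List.Relation.Binary.BagAndSetEquality using (∼bag⇒↭)
  open import Data.List.Relation.Binary.Disjoint.Propositional using (Disjoint)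
  open import Data.List.Relation.Binary.Permutation.Propositional
    using (_↭_; ↭-sym; ↭-trans; ↭-refl; ↭-prep; ↭-swap; ↭⇒↭ₛ)
  open import Data.List.Relation.Binary.Permutation.Propositional.Properties
    using (∈-resp-↭; ↭-length; drop-∷; map⁺)
  import Data.List.Relation.Binary.Permutation.Setoid.Properties as ↭ₛ
  open import Data.List.Relation.Unary.All as All using (All; []; _∷_)
  import Data.List.Relation.Unary.All.Properties as All
  open import Data.List.Relation.Unary.AllPairs as AllPairs using ([]; _∷_)
  import Data.List.Relation.Unary.AllPairs.Properties as AllPairs
  open import Data.List.Relation.Unary.Any using (here; there)
  open import Data.List.Relation.Unary.Unique.Propositional using (Unique)
  import Data.List.Relation.Unary.Unique.Propositional.Properties as Unique
  open import Data.Nat as ℕ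
    using (ℕ; zero; suc; _+_; _*_; _∸_; _^_; _/_; _!; _≤_; _<_; z≤n; s≤s; NonZero)
  open import Data.Nat.Combinatorics
    using (nCk+nC[k+1]≡[n+1]C[k+1]; nC1≡n) renaming (_C_ to infixl 7.5 _choose_)
  open import Data.Nat.DivMod using (m≡m%n+[m/n]*n; m%n<n; m/n*n≤m)
  open import Data.Nat.ListAction using (sum)
  open import Data.Nat.ListAction.Properties using (sum-++; sum-↭)
  open import Data.Nat.Properties
  open import Data.Nat.Tactic.RingSolver using (solve-∀)
  open import Data.Product using (_×_; _,_; ∃-syntax; proj₁; proj₂)
  open import Data.Sum using (inj₁; inj₂; [_,_])
  open import Data.Vec as Vec using (Vec; []; _∷_; here; lookup)
  open import Data.Vec.Membership.Propositional.Properties using (∈-lookup; ∈-toList⁺; ∈-toList⁻)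
  open import Data.Vec.Properties
    using (lookup-concat; lookup-map; lookup⇒[]=; []=⇒lookup; lookup∘tabulate; tabulate∘lookup; tabulate-cong
          ; zipWith-++; length-toList; toList-map; toList-replicate)
  import Data.Vec.Properties as Vec
  import Data.Vec.Relation.Unary.Any as VecAny
  open import Data.Vec.Relation.Unary.Any.Properties using (lookup-index)
  open import Function using (_∘_; const; it; mk⇔)
  open import Relation.Binary.PropositionalEquality hiding ([_])
  open import Relation.Nullary using (Dec; yes; no; does; ¬_; contradiction)
  open import Relation.Nullary.Decidable using (_×-dec_)
  open import Relation.Unary using (Decidable)

  private variable
    A B : Set
    P P′ : Set

  -- The operators p E + z on sequences, where E is the shift

  shift : ℕ → ℕ → (ℕ → ℕ) → ℕ → ℕ
  shift p z f t = p * f (suc t) + z * f t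

  shift^ : ℕ → ℕ → ℕ → (ℕ → ℕ) → ℕ → ℕ
  shift^ p z zero    f = f
  shift^ p z (suc r) f = shift p z (shift^ p z r f)

  shifts : ℕ → List ℕ → (ℕ → ℕ) → ℕ → ℕ
  shifts p []       f = f
  shifts p (z ∷ zs) f = shift p z (shifts p zs f)

  shift-mono : ∀ p z {f g : ℕ → ℕ} → (∀ t → f t ≤ g t) → ∀ t → shift p z f t ≤ shift p z g t
  shift-mono p z f≤g t = +-mono-≤ (*-monoʳ-≤ p (f≤g (suc t))) (*-monoʳ-≤ z (f≤g t))

  shift-*ˡ : ∀ c p z f t → c * shift p z f t ≡ shift p z (λ s → c * f s) t
  shift-*ˡ c p z f t = lemma c p z (f (suc t)) (f t)
    where
    lemma : ∀ c p z a b → c * (p * a + z * b) ≡ p * (c * a) + z * (c * b)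
    lemma = solve-∀

  shift-scale : ∀ c p z f t → shift (c * p) (c * z) f t ≡ c * shift p z f t
  shift-scale c p z f t = lemma c p z (f (suc t)) (f t)
    where
    lemma : ∀ c p z a b → c * p * a + c * z * b ≡ c * (p * a + z * b)
    lemma = solve-∀

  shift-+ʳ : ∀ p z c f t → shift p (z + c) f t ≡ shift p z f t + c * f t
  shift-+ʳ p z c f t = lemma p z c (f (suc t)) (f t)
    where
    lemma : ∀ p z c a b → p * a + (z + c) * b ≡ p * a + z * b + c * b
    lemma = solve-∀

  shift-+ : ∀ p z (f g : ℕ → ℕ) t → shift p z (λ s → f s + g s) t ≡ shift p z f t + shift p z g t
  shift-+ p z f g t = lemma p z (f (suc t)) (g (suc t)) (f t) (g t)
    where
    lemma : ∀ p z a b c d → p * (a + b) + z * (c + d) ≡ p * a + z * c + (p * b + z * d)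
    lemma = solve-∀

  shift-comm : ∀ p x y f t → shift p x (shift p y f) t ≡ shift p y (shift p x f) t
  shift-comm p x y f t = lemma p x y (f (suc (suc t))) (f (suc t)) (f t)
    where
    lemma : ∀ p x y a b c →
      p * (p * a + y * b) + x * (p * b + y * c) ≡ p * (p * a + x * b) + y * (p * b + x * c)
    lemma = solve-∀

  shift-cong : ∀ p z {f g : ℕ → ℕ} → (∀ t → f t ≡ g t) → ∀ t → shift p z f t ≡ shift p z g t
  shift-cong p z f≡g t = cong₂ (λ a b → p * a + z * b) (f≡g (suc t)) (f≡g t)

  shift^-scale : ∀ c p z r f t → shift^ (c * p) (c * z) r f t ≡ c ^ r * shift^ p z r f t
  shift^-scale c p z zero    f t = sym (*-identityˡ _)
  shift^-scale c p z (suc r) f t = begin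
    shift (c * p) (c * z) (shift^ (c * p) (c * z) r f) t  ≡⟨ shift-cong (c * p) (c * z) (shift^-scale c p z r f) t ⟩
    shift (c * p) (c * z) (λ s → c ^ r * shift^ p z r f s) t  ≡⟨ shift-scale c p z (λ s → c ^ r * shift^ p z r f s) t ⟩
    c * shift p z (λ s → c ^ r * shift^ p z r f s) t  ≡⟨ cong (c *_) (shift-*ˡ (c ^ r) p z (shift^ p z r f) t) ⟨
    c * (c ^ r * shift p z (shift^ p z r f) t)  ≡⟨ *-assoc c _ _ ⟨
    c ^ suc r * shift^ p z (suc r) f t  ∎
    where open ≡-Reasoning

  shift^-monoᶻ : ∀ p x c r f t → shift^ p x r f t ≤ shift^ p (x + c) r f t
  shift^-monoᶻ p x c zero    f t = ≤-refl
  shift^-monoᶻ p x c (suc r) f t = ≤-trans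
    (shift-mono p x (shift^-monoᶻ p x c r f) t)
    (≤-trans (m≤m+n _ _) (≤-reflexive (sym (shift-+ʳ p x c (shift^ p (x + c) r f) t))))

  -- With a = p E + x and b = a + c this is a (bʳ - aʳ) ≤ r c bʳ, a tangent bound for the power,
  -- with the subtraction moved across. The induction multiplies by b and uses aʳ⁺¹ ≤ bʳ⁺¹.
  shift-tangent : ∀ p x c r f t →
    shift p x (shift^ p (x + c) r f) t ≤ shift^ p x (suc r) f t + r * c * shift^ p (x + c) r f t
  shift-tangent p x c zero    f t = m≤m+n _ _
  shift-tangent p x c (suc r) f t = begin
    shift p x (shift p (x + c) g) t
      ≡⟨ shift-comm p x (x + c) g t ⟩
    shift p (x + c) (shift p x g) t
      ≤⟨ shift-mono p (x + c) (shift-tangent p x c r f) t ⟩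
    shift p (x + c) (λ s → h s + r * c * g s) t
      ≡⟨ shift-+ p (x + c) h (λ s → r * c * g s) t ⟩
    shift p (x + c) h t + shift p (x + c) (λ s → r * c * g s) t
      ≡⟨ cong₂ _+_ (shift-+ʳ p x c h t) (sym (shift-*ˡ (r * c) p (x + c) g t)) ⟩
    shift p x h t + c * h t + r * c * shift p (x + c) g t
      ≤⟨ +-monoˡ-≤ _ (+-monoʳ-≤ (shift p x h t) (*-monoʳ-≤ c (shift^-monoᶻ p x c (suc r) f t))) ⟩
    shift p x h t + c * shift p (x + c) g t + r * c * shift p (x + c) g t
      ≡⟨ lemma (shift p x h t) c r (shift p (x + c) g t) ⟩
    shift p x h t + suc r * c * shift p (x + c) g t  ∎
    where
    open ≤-Reasoning
    g h : ℕ → ℕ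
    g = shift^ p (x + c) r f
    h = shift^ p x (suc r) f
    lemma : ∀ u c r v → u + c * v + r * c * v ≡ u + suc r * c * v
    lemma = solve-∀

  -- The left side is the first two terms of the binomial expansion of (a + c)ʳ⁺¹ for a = p E + y;
  -- the other terms have nonnegative coefficients.
  shift-bernoulli : ∀ p y c r f t →
    shift^ p y (suc r) f t + suc r * c * shift^ p y r f t ≤ shift^ p (y + c) (suc r) f t
  shift-bernoulli p y c zero    f t = ≤-reflexive
    (trans (cong (λ d → shift p y f t + d * f t) (*-identityˡ c)) (sym (shift-+ʳ p y c f t)))
  shift-bernoulli p y c (suc r) f t = begin
    shift p y (shift p y g) t + suc (suc r) * c * shift p y g t
      ≤⟨ ≤-trans (m≤m+n _ (suc r * c * c * g t)) (≤-reflexive (lemma (shift p y (shift p y g) t) r c (shift p y g t) (g t))) ⟩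
    (shift p y (shift p y g) t + c * shift p y g t) + suc r * c * (shift p y g t + c * g t)
      ≡⟨ cong₂ (λ a b → a + suc r * c * b) (shift-+ʳ p y c (shift p y g) t) (shift-+ʳ p y c g t) ⟨
    shift p (y + c) (shift p y g) t + suc r * c * shift p (y + c) g t
      ≡⟨ cong (shift p (y + c) (shift p y g) t +_) (shift-*ˡ (suc r * c) p (y + c) g t) ⟩
    shift p (y + c) (shift p y g) t + shift p (y + c) (λ s → suc r * c * g s) t
      ≡⟨ shift-+ p (y + c) (shift p y g) (λ s → suc r * c * g s) t ⟨
    shift p (y + c) (λ s → shift p y g s + suc r * c * g s) t
      ≤⟨ shift-mono p (y + c) (shift-bernoulli p y c r f) t ⟩
    shift^ p (y + c) (suc (suc r)) f t  ∎
    where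
    open ≤-Reasoning
    g : ℕ → ℕ
    g = shift^ p y r f
    lemma : ∀ a r c b d → a + suc (suc r) * c * b + suc r * c * c * d ≡ (a + c * b) + suc r * c * (b + c * d)
    lemma = solve-∀

  -- Weighted AM–GM, coefficient by coefficient in powers of the shift: subtracting the two sides would
  -- need signed operators, hence the two cases y ≥ x and y ≤ x.
  shift-amgm : ∀ p w x y r f t → w + r * y ≡ suc r * x →
    shift p w (shift^ p y r f) t ≤ shift^ p x (suc r) f t
  shift-amgm p w x y r f t eq with ≤-total x y
  ... | inj₁ x≤y with c , refl ← m≤n⇒∃[o]m+o≡n x≤y = +-cancelʳ-≤ (r * c * g t) _ _ (begin
    shift p w g t + r * c * g t  ≡⟨ shift-+ʳ p w (r * c) g t ⟨
    shift p (w + r * c) g t      ≡⟨ cong (λ v → shift p v g t) w+rc≡x ⟩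
    shift p x g t                ≤⟨ shift-tangent p x c r f t ⟩
    shift^ p x (suc r) f t + r * c * g t  ∎)
    where
    open ≤-Reasoning
    g : ℕ → ℕ
    g = shift^ p (x + c) r f
    lemma : ∀ r x c w → w + r * c + r * x ≡ w + r * (x + c)
    lemma = solve-∀
    w+rc≡x : w + r * c ≡ x
    w+rc≡x = +-cancelʳ-≡ (r * x) _ _ (trans (lemma r x c w) eq)
  ... | inj₂ y≤x with c , refl ← m≤n⇒∃[o]m+o≡n y≤x = begin
    shift p w g t                        ≡⟨ cong (λ v → shift p v g t) w≡ ⟩
    shift p (y + suc r * c) g t          ≡⟨ shift-+ʳ p y (suc r * c) g t ⟩
    shift p y g t + suc r * c * g t      ≤⟨ shift-bernoulli p y c r f t ⟩
    shift^ p (y + c) (suc r) f t         ∎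
    where
    open ≤-Reasoning
    g : ℕ → ℕ
    g = shift^ p y r f
    lemma : ∀ r y c → suc r * (y + c) ≡ y + suc r * c + r * y
    lemma = solve-∀
    w≡ : w ≡ y + suc r * c
    w≡ = +-cancelʳ-≡ (r * y) _ _ (trans eq (lemma r y c))

  -- The elementary symmetric functions of zs are largest, for a given sum, when all entries are equal.
  shifts-maclaurin : ∀ p zs f t →
    length zs ^ length zs * shifts p zs f t ≤ shift^ (length zs * p) (sum zs) (length zs) f t
  shifts-maclaurin p []           f t = ≤-reflexive (*-identityˡ _)
  -- A single entry is treated apart, since the step below cancels a power of the length of the
  -- tail.
  shifts-maclaurin p (z ∷ [])     f t = ≤-reflexive (trans (*-identityˡ _)
    (cong₂ (λ a b → shift a b f t) (sym (*-identityˡ p)) (sym (+-identityʳ z))))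
  -- Multiplied by r (r + 1), the new entry, the mean of the tail and the mean of all entries become
  -- the integers r (r + 1) z, (r + 1) Σ zs and r (z + Σ zs) that `shift-amgm` compares.
  shifts-maclaurin p (z ∷ zs@(_ ∷ _)) f t = *-cancelˡ-≤ (r ^ suc r) {{m^n≢0 r (suc r)}} (begin
    r ^ suc r * (suc r ^ suc r * shift p z g t)
      ≡⟨ lemma₁ r (r ^ r) (suc r ^ r) (shift p z g t) ⟩
    r * suc r * (suc r ^ r * (r ^ r * shift p z g t))
      ≡⟨ cong (λ v → r * suc r * (suc r ^ r * v)) (shift-*ˡ (r ^ r) p z g t) ⟩
    r * suc r * (suc r ^ r * shift p z (λ s → r ^ r * g s) t)
      ≤⟨ *-monoʳ-≤ (r * suc r) (*-monoʳ-≤ (suc r ^ r) (shift-mono p z (shifts-maclaurin p zs f) t)) ⟩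
    r * suc r * (suc r ^ r * shift p z h t)
      ≡⟨ cong (r * suc r *_) (shift-*ˡ (suc r ^ r) p z h t) ⟩
    r * suc r * shift p z (λ s → suc r ^ r * h s) t
      ≡⟨ cong (r * suc r *_) (shift-cong p z (shift^-scale (suc r) (r * p) (sum zs) r f) t) ⟨
    r * suc r * shift p z (shift^ (suc r * (r * p)) (suc r * sum zs) r f) t
      ≡⟨ shift-scale (r * suc r) p z (shift^ (suc r * (r * p)) (suc r * sum zs) r f) t ⟨
    shift (r * suc r * p) (r * suc r * z) (shift^ (suc r * (r * p)) (suc r * sum zs) r f) t
      ≡⟨ cong (λ q → shift (r * suc r * p) (r * suc r * z) (shift^ q (suc r * sum zs) r f) t) (lemma₃ r p) ⟩
    shift (r * suc r * p) (r * suc r * z) (shift^ (r * suc r * p) (suc r * sum zs) r f) t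
      ≤⟨ shift-amgm (r * suc r * p) (r * suc r * z) (r * (z + sum zs)) (suc r * sum zs) r f t (lemma₂ r z (sum zs)) ⟩
    shift^ (r * suc r * p) (r * (z + sum zs)) (suc r) f t
      ≡⟨ cong (λ q → shift^ q (r * (z + sum zs)) (suc r) f t) (*-assoc r (suc r) p) ⟩
    shift^ (r * (suc r * p)) (r * (z + sum zs)) (suc r) f t
      ≡⟨ shift^-scale r (suc r * p) (z + sum zs) (suc r) f t ⟩
    r ^ suc r * shift^ (suc r * p) (z + sum zs) (suc r) f t  ∎)
    where
    open ≤-Reasoning
    r : ℕ
    r = length zs
    g h : ℕ → ℕ
    g = shifts p zs f
    h = shift^ (r * p) (sum zs) r f
    lemma₁ : ∀ r a b v → r * a * (suc r * b * v) ≡ r * suc r * (b * (a * v))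
    lemma₁ = solve-∀
    lemma₂ : ∀ r z d → r * suc r * z + r * (suc r * d) ≡ suc r * (r * (z + d))
    lemma₂ = solve-∀
    lemma₃ : ∀ r p → suc r * (r * p) ≡ r * suc r * p
    lemma₃ = solve-∀

  -- Shifting t! multiplies it by t + 1; this moves the factor t + 1 past the powers of the operator.
  shift^-!-suc : ∀ p z n t →
    shift^ p z (suc n) _! (suc t) + suc n * z * shift^ p z n _! t ≡ (t + suc (suc n)) * shift^ p z (suc n) _! t
  shift^-!-suc p z zero    t = lemma p z t (t !)
    where
    lemma : ∀ p z t a → p * (suc (suc t) * (suc t * a)) + z * (suc t * a) + 1 * z * a
                        ≡ (t + 2) * (p * (suc t * a) + z * a)
    lemma = solve-∀
  shift^-!-suc p z (suc n) t = begin
    p * F (suc (suc t)) + z * F (suc t) + suc (suc n) * z * F t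
      ≡⟨⟩
    p * F (suc (suc t)) + z * F (suc t) + suc (suc n) * z * (p * G (suc t) + z * G t)
      ≡⟨ lemma₁ p z n (F (suc (suc t))) (F (suc t)) (G (suc t)) (G t) ⟩
    p * (F (suc (suc t)) + suc n * z * G (suc t)) + z * (F (suc t) + suc n * z * G t) + z * F t
      ≡⟨ cong₂ (λ a b → p * a + z * b + z * F t) (shift^-!-suc p z n (suc t)) (shift^-!-suc p z n t) ⟩
    p * ((suc t + suc (suc n)) * F (suc t)) + z * ((t + suc (suc n)) * F t) + z * F t
      ≡⟨ lemma₂ p z t n (F (suc t)) (F t) ⟩
    (t + suc (suc (suc n))) * (p * F (suc t) + z * F t)  ∎
    where
    open ≡-Reasoning
    F G : ℕ → ℕ
    F = shift^ p z (suc n) _!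
    G = shift^ p z n _!
    lemma₁ : ∀ p z n a b c d → p * a + z * b + suc (suc n) * z * (p * c + z * d)
                            ≡ p * (a + suc n * z * c) + z * (b + suc n * z * d) + z * (p * c + z * d)
    lemma₁ = solve-∀
    lemma₂ : ∀ p z t n b c → p * ((suc t + suc (suc n)) * b) + z * ((t + suc (suc n)) * c) + z * c
                          ≡ (t + suc (suc (suc n))) * (p * b + z * c)
    lemma₂ = solve-∀

  -- At t = 0, (p E + z)ⁿ applied to the factorial is n! pⁿ times the exponential series at z / p
  -- truncated after the n-th power, and one more term is added. For general t, the terms with zʲ
  -- compare by (n + 1 - j) (t + n - j)! ≤ (t + n + 1 - j)!.
  shift^-!-growth : ∀ p z n t → suc n * p * shift^ p z n _! t ≤ shift^ p z (suc n) _! t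
  shift^-!-growth p z zero    t = begin
    1 * p * t !                    ≤⟨ m≤m+n _ _ ⟩
    1 * p * t ! + (p * (t * t !) + z * t !)  ≡⟨ lemma p z t (t !) ⟩
    p * (suc t * t !) + z * t !    ∎
    where
    open ≤-Reasoning
    lemma : ∀ p z t a → 1 * p * a + (p * (t * a) + z * a) ≡ p * (suc t * a) + z * a
    lemma = solve-∀
  shift^-!-growth p z (suc n) t = +-cancelʳ-≤ (p * (suc n * z * G t)) _ _ (begin
    suc (suc n) * p * F t + p * (suc n * z * G t)
      ≡⟨ lemma₁ p z n (F t) (G t) ⟩
    suc (suc n) * p * F t + z * (suc n * p * G t)
      ≤⟨ +-mono-≤ (≤-trans (m≤m+n _ (t * p * F t)) (≤-reflexive (lemma₂ n p t (F t)))) (*-monoʳ-≤ z (shift^-!-growth p z n t)) ⟩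
    p * ((t + suc (suc n)) * F t) + z * F t
      ≡⟨ cong (λ v → p * v + z * F t) (shift^-!-suc p z n t) ⟨
    p * (F (suc t) + suc n * z * G t) + z * F t
      ≡⟨ lemma₃ p z (F (suc t)) (suc n * z * G t) (F t) ⟩
    p * F (suc t) + z * F t + p * (suc n * z * G t)  ∎)
    where
    open ≤-Reasoning
    F G : ℕ → ℕ
    F = shift^ p z (suc n) _!
    G = shift^ p z n _!
    lemma₁ : ∀ p z n a b → suc (suc n) * p * a + p * (suc n * z * b) ≡ suc (suc n) * p * a + z * (suc n * p * b)
    lemma₁ = solve-∀
    lemma₂ : ∀ n p t a → suc (suc n) * p * a + t * p * a ≡ p * ((t + suc (suc n)) * a)
    lemma₂ = solve-∀
    lemma₃ : ∀ p z a b c → p * (a + b) + z * c ≡ p * a + z * c + p * b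
    lemma₃ = solve-∀

  -- The truncated form of e ^ (x + c) (1 - c) ≤ e ^ x, with x and c measured in units of p.
  shift^-!-step : ∀ d c x n t → let p = d + c in
    d * shift^ p (x + c) n _! t ≤ p * shift^ p x n _! t
  shift^-!-step d c x zero    t = *-monoˡ-≤ _ (m≤m+n d c)
  shift^-!-step d c x (suc n) t = +-cancelʳ-≤ (c * V (x + c) (suc n)) _ _ (begin
    d * V (x + c) (suc n) + c * V (x + c) (suc n)
      ≡⟨ *-distribʳ-+ (V (x + c) (suc n)) d c ⟨
    p * V (x + c) (suc n)
      ≡⟨ cong (p *_) (shift-+ʳ p x c (λ s → shift^ p (x + c) n _! s) t) ⟩
    p * (shift p x (shift^ p (x + c) n _!) t + c * V (x + c) n)
      ≤⟨ *-monoʳ-≤ p (+-monoˡ-≤ _ (shift-tangent p x c n _! t)) ⟩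
    p * (V x (suc n) + n * c * V (x + c) n + c * V (x + c) n)
      ≡⟨ lemma p (V x (suc n)) n c (V (x + c) n) ⟩
    p * V x (suc n) + c * (suc n * p * V (x + c) n)
      ≤⟨ +-monoʳ-≤ _ (*-monoʳ-≤ c (shift^-!-growth p (x + c) n t)) ⟩
    p * V x (suc n) + c * V (x + c) (suc n)  ∎)
    where
    open ≤-Reasoning
    p : ℕ
    p = d + c
    V : ℕ → ℕ → ℕ
    V z k = shift^ p z k _! t
    lemma : ∀ p a n c b → p * (a + n * c * b + c * b) ≡ p * a + c * (suc n * p * b)
    lemma = solve-∀

  -- Raising z from 0 to M c in M steps of size c gives the bound (1 - c / p)⁻ᴹ. For M = n this form
  -- can be compared with the desired (1 + c / p)ⁿ: the two differ by the factor (1 - c² / p²)⁻ⁿ.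
  shift^-!-bound : ∀ d c n t M → let p = d + c in
    d ^ M * shift^ p (M * c) n _! t ≤ p ^ M * shift^ p 0 n _! t
  shift^-!-bound d c n t zero    = ≤-refl
  shift^-!-bound d c n t (suc M) = begin
    d ^ suc M * shift^ p (suc M * c) n _! t     ≡⟨ cong₂ _*_ (*-comm d (d ^ M)) (cong (λ z → shift^ p z n _! t) (+-comm c (M * c))) ⟩
    d ^ M * d * shift^ p (M * c + c) n _! t     ≡⟨ *-assoc (d ^ M) d _ ⟩
    d ^ M * (d * shift^ p (M * c + c) n _! t)   ≤⟨ *-monoʳ-≤ (d ^ M) (shift^-!-step d c (M * c) n t) ⟩
    d ^ M * (p * shift^ p (M * c) n _! t)       ≡⟨ lemma (d ^ M) p (shift^ p (M * c) n _! t) ⟩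
    p * (d ^ M * shift^ p (M * c) n _! t)       ≤⟨ *-monoʳ-≤ p (shift^-!-bound d c n t M) ⟩
    p * (p ^ M * shift^ p 0 n _! t)             ≡⟨ *-assoc p (p ^ M) _ ⟨
    p ^ suc M * shift^ p 0 n _! t               ∎
    where
    open ≤-Reasoning
    p : ℕ
    p = d + c
    lemma : ∀ a p v → a * (p * v) ≡ p * (a * v)
    lemma = solve-∀

  shift^-0-! : ∀ p n t → shift^ p 0 n _! t ≡ p ^ n * (t + n) !
  shift^-0-! p zero    t = trans (cong _! (sym (+-identityʳ t))) (sym (*-identityˡ _))
  shift^-0-! p (suc n) t = begin
    p * shift^ p 0 n _! (suc t) + 0       ≡⟨ +-identityʳ _ ⟩
    p * shift^ p 0 n _! (suc t)           ≡⟨ cong (p *_) (shift^-0-! p n (suc t)) ⟩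
    p * (p ^ n * (suc t + n) !)           ≡⟨ *-assoc p (p ^ n) _ ⟨
    p ^ suc n * (suc t + n) !             ≡⟨ cong (λ v → p ^ suc n * v !) (+-suc t n) ⟨
    p ^ suc n * (t + suc n) !             ∎
    where open ≡-Reasoning

  -- Bernoulli's inequality for powers of natural numbers

  ^-bernoulli : ∀ B d l → (B + d) * (B + d) ^ l ≤ (B + d) * B ^ l + l * d * (B + d) ^ l
  ^-bernoulli B d zero    = m≤m+n _ _
  ^-bernoulli B d (suc l) = begin
    S * (S * S ^ l)                              ≤⟨ *-monoʳ-≤ S (^-bernoulli B d l) ⟩
    S * (S * B ^ l + l * d * S ^ l)              ≡⟨ lemma B d l (B ^ l) (S ^ l) ⟩
    S * (B * B ^ l) + (S * d * B ^ l + S * (l * d * S ^ l))  ≤⟨ +-monoʳ-≤ (S * (B * B ^ l)) (+-monoˡ-≤ _ (*-monoʳ-≤ (S * d) (^-monoˡ-≤ l (m≤m+n B d)))) ⟩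
    S * (B * B ^ l) + (S * d * S ^ l + S * (l * d * S ^ l))  ≡⟨ cong (S * (B * B ^ l) +_) (lemma′ S d l (S ^ l)) ⟩
    S * (B * B ^ l) + suc l * d * (S * S ^ l)    ∎
    where
    open ≤-Reasoning
    S : ℕ
    S = B + d
    lemma : ∀ B d l b a → (B + d) * ((B + d) * b + l * d * a) ≡ (B + d) * (B * b) + ((B + d) * d * b + (B + d) * (l * d * a))
    lemma = solve-∀
    lemma′ : ∀ S d l a → S * d * a + S * (l * d * a) ≡ suc l * d * (S * a)
    lemma′ = solve-∀

  -- Bernoulli's inequality (B / (B + d)) ^ l ≥ 1 - l d / (B + d) ≥ 1 / 2.
  ^-half : ∀ B d l → .{{NonZero (B + d)}} → 2 * (l * d) ≤ B + d → (B + d) ^ l ≤ 2 * B ^ l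
  ^-half B d l h = *-cancelˡ-≤ S (+-cancelʳ-≤ (S * S ^ l) _ _ (begin
    S * S ^ l + S * S ^ l                              ≤⟨ +-mono-≤ (^-bernoulli B d l) (^-bernoulli B d l) ⟩
    S * B ^ l + l * d * S ^ l + (S * B ^ l + l * d * S ^ l)  ≡⟨ lemma S (B ^ l) (l * d) (S ^ l) ⟩
    S * (2 * B ^ l) + 2 * (l * d) * S ^ l              ≤⟨ +-monoʳ-≤ _ (*-monoˡ-≤ (S ^ l) h) ⟩
    S * (2 * B ^ l) + S * S ^ l                        ∎))
    where
    open ≤-Reasoning
    S : ℕ
    S = B + d
    lemma : ∀ S b k a → S * b + k * a + (S * b + k * a) ≡ S * (2 * b) + 2 * k * a
    lemma = solve-∀

  ^-distrib-* : ∀ m n k → (m * n) ^ k ≡ m ^ k * n ^ k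
  ^-distrib-* m n zero    = refl
  ^-distrib-* m n (suc k) = trans (cong (m * n *_) (^-distrib-* m n k)) (lemma m n (m ^ k) (n ^ k))
    where
    lemma : ∀ m n a b → m * n * (a * b) ≡ m * a * (n * b)
    lemma = solve-∀

  -- With p = d + c: p² - c² = (p + c) d, and the hypothesis on c makes ((p² - c²) / p²) ^ n at least 1/2.
  shift^-!-upper : ∀ d c n → let p = d + c in .{{NonZero p}} → 2 * (n * (c * c)) ≤ p * p →
    shift^ p (n * c) n _! 0 ≤ 2 * ((p + c) ^ n * n !)
  shift^-!-upper d c n h = *-cancelˡ-≤ (p ^ n * p ^ n) {{m*n≢0 (p ^ n) (p ^ n) {{m^n≢0 p n}} {{m^n≢0 p n}}}} (begin
    p ^ n * p ^ n * V
      ≡⟨ cong (_* V) (^-distrib-* p p n) ⟨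
    (p * p) ^ n * V
      ≤⟨ *-monoˡ-≤ V halved ⟩
    2 * ((p + c) * d) ^ n * V
      ≡⟨ cong (λ v → 2 * v * V) (^-distrib-* (p + c) d n) ⟩
    2 * ((p + c) ^ n * d ^ n) * V
      ≡⟨ lemma₂ ((p + c) ^ n) (d ^ n) V ⟩
    2 * (p + c) ^ n * (d ^ n * V)
      ≤⟨ *-monoʳ-≤ (2 * (p + c) ^ n) (shift^-!-bound d c n 0 n) ⟩
    2 * (p + c) ^ n * (p ^ n * shift^ p 0 n _! 0)
      ≡⟨ cong (λ v → 2 * (p + c) ^ n * (p ^ n * v)) (shift^-0-! p n 0) ⟩
    2 * (p + c) ^ n * (p ^ n * (p ^ n * n !))
      ≡⟨ lemma₃ ((p + c) ^ n) (p ^ n) (n !) ⟩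
    p ^ n * p ^ n * (2 * ((p + c) ^ n * n !))  ∎)
    where
    open ≤-Reasoning
    p V : ℕ
    p = d + c
    V = shift^ p (n * c) n _! 0
    lemma₁ : ∀ d c → (d + c + c) * d + c * c ≡ (d + c) * (d + c)
    lemma₁ = solve-∀
    lemma₂ : ∀ a b v → 2 * (a * b) * v ≡ 2 * a * (b * v)
    lemma₂ = solve-∀
    lemma₃ : ∀ a b v → 2 * a * (b * (b * v)) ≡ b * b * (2 * (a * v))
    lemma₃ = solve-∀
    halved : (p * p) ^ n ≤ 2 * ((p + c) * d) ^ n
    halved = subst (λ v → v ^ n ≤ 2 * ((p + c) * d) ^ n) (lemma₁ d c)
      (^-half ((p + c) * d) (c * c) n {{subst NonZero (sym (lemma₁ d c)) (m*n≢0 p p)}}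
        (≤-trans h (≤-reflexive (sym (lemma₁ d c)))))

  -- Permanents

  ∑ : List A → (A → ℕ) → ℕ
  ∑ xs f = sum (map f xs)

  ∑-cong : ∀ (xs : List A) {f g : A → ℕ} → (∀ x → f x ≡ g x) → ∑ xs f ≡ ∑ xs g
  ∑-cong []       h = refl
  ∑-cong (x ∷ xs) h = cong₂ _+_ (h x) (∑-cong xs h)

  ∑-cong-All : {xs : List A} {f g : A → ℕ} → All (λ x → f x ≡ g x) xs → ∑ xs f ≡ ∑ xs g
  ∑-cong-All []       = refl
  ∑-cong-All (h ∷ hs) = cong₂ _+_ h (∑-cong-All hs)

  ∑-mono : {xs : List A} {f g : A → ℕ} → All (λ x → f x ≤ g x) xs → ∑ xs f ≤ ∑ xs g
  ∑-mono []       = z≤n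
  ∑-mono (h ∷ hs) = +-mono-≤ h (∑-mono hs)

  ∑-++ : ∀ (xs ys : List A) f → ∑ (xs ++ ys) f ≡ ∑ xs f + ∑ ys f
  ∑-++ xs ys f = trans (cong sum (map-++ f xs ys)) (sum-++ (map f xs) (map f ys))

  ∑-map : ∀ (xs : List A) (h : A → B) f → ∑ (map h xs) f ≡ ∑ xs (f ∘ h)
  ∑-map xs h f = cong sum (sym (map-∘ xs))

  ∑-concatMap : ∀ (xs : List A) (h : A → List B) f → ∑ (concatMap h xs) f ≡ ∑ xs (λ x → ∑ (h x) f)
  ∑-concatMap []       h f = refl
  ∑-concatMap (x ∷ xs) h f = trans (∑-++ (h x) (concatMap h xs) f) (cong (∑ (h x) f +_) (∑-concatMap xs h f))

  ∑-*ˡ : ∀ c (xs : List A) f → ∑ xs (λ x → c * f x) ≡ c * ∑ xs f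
  ∑-*ˡ c []       f = sym (*-zeroʳ c)
  ∑-*ˡ c (x ∷ xs) f = trans (cong (c * f x +_) (∑-*ˡ c xs f)) (sym (*-distribˡ-+ c (f x) (∑ xs f)))

  ∑-*ʳ : ∀ c (xs : List A) f → ∑ xs (λ x → f x * c) ≡ ∑ xs f * c
  ∑-*ʳ c xs f = trans (∑-cong xs (λ x → *-comm (f x) c)) (trans (∑-*ˡ c xs f) (*-comm c _))

  ∑-+ : ∀ (xs : List A) f g → ∑ xs (λ x → f x + g x) ≡ ∑ xs f + ∑ xs g
  ∑-+ []       f g = refl
  ∑-+ (x ∷ xs) f g = trans (cong (f x + g x +_) (∑-+ xs f g)) (lemma (f x) (g x) (∑ xs f) (∑ xs g))
    where
    lemma : ∀ a b c d → a + b + (c + d) ≡ a + c + (b + d)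
    lemma = solve-∀

  ∑-const : ∀ (xs : List A) c → ∑ xs (λ _ → c) ≡ length xs * c
  ∑-const []       c = refl
  ∑-const (x ∷ xs) c = cong (c +_) (∑-const xs c)

  ∑-0 : ∀ (xs : List A) → ∑ xs (λ _ → 0) ≡ 0
  ∑-0 xs = trans (∑-const xs 0) (*-zeroʳ (length xs))

  ∑-swap : ∀ (xs : List A) (ys : List B) (f : A → B → ℕ) → ∑ xs (λ x → ∑ ys (f x)) ≡ ∑ ys (λ y → ∑ xs (λ x → f x y))
  ∑-swap []       ys f = sym (∑-0 ys)
  ∑-swap (x ∷ xs) ys f = trans (cong (∑ ys (f x) +_) (∑-swap xs ys f)) (sym (∑-+ ys (f x) _))

  picks : List A → List (A × List A)
  picks []       = []
  picks (x ∷ xs) = (x , xs) ∷ map (λ (y , ys) → y , x ∷ ys) (picks xs)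

  permanent : List (A → ℕ) → List A → ℕ
  permanent []       L = 1
  permanent (w ∷ ws) L = ∑ (picks L) (λ (x , L′) → w x * permanent ws L′)

  picks-length : (L : List A) → All (λ (_ , L′) → suc (length L′) ≡ length L) (picks L)
  picks-length []      = []
  picks-length (x ∷ L) = refl ∷ All.map⁺ (All.map (cong suc) (picks-length L))

  picks-∑ : (χ : A → ℕ) (L : List A) → All (λ (x , L′) → χ x + ∑ L′ χ ≡ ∑ L χ) (picks L)
  picks-∑ χ []      = []
  picks-∑ χ (x ∷ L) = refl ∷ All.map⁺ (All.map (λ {(y , L′)} e → trans (lemma (χ y) (χ x) (∑ L′ χ)) (cong (χ x +_) e)) (picks-∑ χ L))
    where
    lemma : ∀ a b c → a + (b + c) ≡ b + (a + c)
    lemma = solve-∀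

  ∑-picks-proj₁ : ∀ (L : List A) χ → ∑ (picks L) (χ ∘ proj₁) ≡ ∑ L χ
  ∑-picks-proj₁ []      χ = refl
  ∑-picks-proj₁ (x ∷ L) χ = cong (χ x +_) (trans (∑-map (picks L) _ _) (∑-picks-proj₁ L χ))

  ∑-picks² : List A → (A → A → List A → ℕ) → ℕ
  ∑-picks² L F = ∑ (picks L) (λ (x , L′) → ∑ (picks L′) (λ (y , L″) → F x y L″))

  ∑-picks²-∷ : ∀ (z : A) L F → ∑-picks² (z ∷ L) F ≡
    ∑ (picks L) (λ (x , L′) → F z x L′ + F x z L′) + ∑-picks² L (λ x y L″ → F x y (z ∷ L″))
  ∑-picks²-∷ z L F = begin
    ∑ (picks L) (λ (x , L′) → F z x L′) +
      ∑ (map _ (picks L)) (λ (x , L′) → ∑ (picks L′) (λ (y , L″) → F x y L″))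
      ≡⟨ cong (∑ (picks L) (λ (x , L′) → F z x L′) +_) (trans (∑-map (picks L) _ _)
          (trans (∑-cong (picks L) λ (x , L′) → cong (F x z L′ +_) (∑-map (picks L′) _ _))
            (∑-+ (picks L) (λ (x , L′) → F x z L′) _))) ⟩
    ∑ (picks L) (λ (x , L′) → F z x L′) + (∑ (picks L) (λ (x , L′) → F x z L′) + ∑-picks² L (λ x y L″ → F x y (z ∷ L″)))
      ≡⟨ +-assoc (∑ (picks L) (λ (x , L′) → F z x L′)) _ _ ⟨
    ∑ (picks L) (λ (x , L′) → F z x L′) + ∑ (picks L) (λ (x , L′) → F x z L′) + ∑-picks² L (λ x y L″ → F x y (z ∷ L″))
      ≡⟨ cong (_+ ∑-picks² L (λ x y L″ → F x y (z ∷ L″))) (∑-+ (picks L) (λ (x , L′) → F z x L′) _) ⟨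
    ∑ (picks L) (λ (x , L′) → F z x L′ + F x z L′) + ∑-picks² L (λ x y L″ → F x y (z ∷ L″))  ∎
    where open ≡-Reasoning

  -- The list left by two picks keeps the order of L whichever entry goes first, so F need not be
  -- invariant under permutations of its list. Pairs containing the head occur in both orders, which
  -- makes the first sum of `∑-picks²-∷` symmetric.
  ∑-picks²-swap : ∀ (L : List A) F → ∑-picks² L F ≡ ∑-picks² L (λ x y → F y x)
  ∑-picks²-swap []      F = refl
  ∑-picks²-swap (z ∷ L) F = trans (∑-picks²-∷ z L F) (trans
    (cong₂ _+_ (∑-cong (picks L) (λ (x , L′) → +-comm (F z x L′) (F x z L′))) (∑-picks²-swap L (λ x y L″ → F x y (z ∷ L″))))
    (sym (∑-picks²-∷ z L (λ x y → F y x))))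

  permanent-∷ : ∀ (v w : A → ℕ) ws L → permanent (v ∷ w ∷ ws) L ≡ ∑-picks² L (λ x y L″ → v x * w y * permanent ws L″)
  permanent-∷ v w ws L = ∑-cong (picks L) λ (x , L′) →
    trans (sym (∑-*ˡ (v x) (picks L′) _)) (∑-cong (picks L′) λ (y , L″) → sym (*-assoc (v x) (w y) _))

  permanent-swap : ∀ (v w : A → ℕ) ws L → permanent (v ∷ w ∷ ws) L ≡ permanent (w ∷ v ∷ ws) L
  permanent-swap v w ws L = begin
    permanent (v ∷ w ∷ ws) L                                   ≡⟨ permanent-∷ v w ws L ⟩
    ∑-picks² L (λ x y L″ → v x * w y * permanent ws L″)         ≡⟨ ∑-picks²-swap L _ ⟩
    ∑-picks² L (λ x y L″ → v y * w x * permanent ws L″)         ≡⟨ ∑-cong (picks L) (λ (x , L′) → ∑-cong (picks L′) λ (y , L″) →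
                                                                    cong (_* permanent ws L″) (*-comm (v y) (w x))) ⟩
    ∑-picks² L (λ x y L″ → w x * v y * permanent ws L″)         ≡⟨ permanent-∷ w v ws L ⟨
    permanent (w ∷ v ∷ ws) L                                   ∎
    where open ≡-Reasoning

  permanent-shift : ∀ (v : A → ℕ) ws us L → permanent (v ∷ ws ++ us) L ≡ permanent (ws ++ v ∷ us) L
  permanent-shift v []       us L = refl
  permanent-shift v (w ∷ ws) us L = trans (permanent-swap v w (ws ++ us) L)
    (∑-cong (picks L) λ (x , L′) → cong (w x *_) (permanent-shift v ws us L′))

  permanent-ones : ∀ t (L : List A) → length L ≡ t → permanent (replicate t (const 1)) L ≡ t !
  permanent-ones zero    L eq = refl
  permanent-ones (suc t) L eq = begin
    ∑ (picks L) (λ (x , L′) → 1 * permanent (replicate t (const 1)) L′)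
      ≡⟨ ∑-cong-All (All.map (λ {p} → step p) (picks-length L)) ⟩
    ∑ (picks L) (λ _ → t !)   ≡⟨ ∑-picks-proj₁ L (λ _ → t !) ⟩
    ∑ L (λ _ → t !)           ≡⟨ ∑-const L (t !) ⟩
    length L * t !            ≡⟨ cong (_* t !) eq ⟩
    suc t !                   ∎
    where
    open ≡-Reasoning
    step : ∀ p → suc (length (proj₂ p)) ≡ length L → 1 * permanent (replicate t (const 1)) (proj₂ p) ≡ t !
    step (_ , L′) e = trans (*-identityˡ _) (permanent-ones t L′ (suc-injective (trans e eq)))

  row : ℕ → ℕ → (A → ℕ) → A → ℕ
  row P Q χ x = P + Q * χ x

  -- A row P + Q χ is split by linearity: a constant row 1 is deferred to the end, where it only counts
  -- the remaining columns, while a row χ is expanded at once and costs its degree.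
  permanent-bound : ∀ P Q (d : (A → ℕ) → ℕ) χs t L → length L ≡ length χs + t → (∀ χ → ∑ L χ ≤ d χ) →
    permanent (map (row P Q) χs ++ replicate t (const 1)) L ≤ shifts P (map (λ χ → Q * d χ) χs) _! t
  permanent-bound P Q d []       t L eq h = ≤-reflexive (permanent-ones t L eq)
  permanent-bound P Q d (χ ∷ χs) t L eq h = begin
    ∑ (picks L) (λ (x , L′) → (P + Q * χ x) * W L′)
      ≡⟨ ∑-cong (picks L) (λ (x , L′) → lemma P Q (χ x) (W L′)) ⟩
    ∑ (picks L) (λ (x , L′) → P * (1 * W L′) + Q * (χ x * W L′))
      ≡⟨ ∑-+ (picks L) (λ (x , L′) → P * (1 * W L′)) (λ (x , L′) → Q * (χ x * W L′)) ⟩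
    ∑ (picks L) (λ (x , L′) → P * (1 * W L′)) + ∑ (picks L) (λ (x , L′) → Q * (χ x * W L′))
      ≡⟨ cong₂ _+_ (∑-*ˡ P (picks L) _) (∑-*ˡ Q (picks L) _) ⟩
    P * permanent (const 1 ∷ ws ++ ones t) L + Q * ∑ (picks L) (λ (x , L′) → χ x * W L′)
      ≤⟨ +-mono-≤ (*-monoʳ-≤ P deferred) (*-monoʳ-≤ Q chosen) ⟩
    P * H (suc t) + Q * (d χ * H t)
      ≡⟨ cong (P * H (suc t) +_) (*-assoc Q (d χ) (H t)) ⟨
    P * H (suc t) + Q * d χ * H t  ∎
    where
    open ≤-Reasoning
    ws = map (row P Q) χs
    ones : ℕ → List (_ → ℕ)
    ones t = replicate t (const 1)
    W : List _ → ℕ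
    W = permanent (ws ++ ones t)
    H : ℕ → ℕ
    H = shifts P (map (λ χ → Q * d χ) χs) _!
    lemma : ∀ P Q c w → (P + Q * c) * w ≡ P * (1 * w) + Q * (c * w)
    lemma = solve-∀
    deferred : permanent (const 1 ∷ ws ++ ones t) L ≤ H (suc t)
    deferred = ≤-trans (≤-reflexive (permanent-shift (const 1) ws (ones t) L))
      (permanent-bound P Q d χs (suc t) L (trans eq (sym (+-suc _ t))) h)
    -- Degrees only shrink when a column is removed, so the bounds `d` stay valid on the remaining
    -- columns.
    chosen : ∑ (picks L) (λ (x , L′) → χ x * W L′) ≤ d χ * H t
    chosen = begin
      ∑ (picks L) (λ (x , L′) → χ x * W L′)
        ≤⟨ ∑-mono (All.map (λ {(x , L′)} (e , le) → *-monoʳ-≤ (χ x)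
             (permanent-bound P Q d χs t L′ (suc-injective (trans e eq))
               (λ χ′ → ≤-trans (le χ′) (h χ′))))
             (All.zip (picks-length L , picks-mono L))) ⟩
      ∑ (picks L) (λ (x , _) → χ x * H t)    ≡⟨ ∑-picks-proj₁ L (λ x → χ x * H t) ⟩
      ∑ L (λ x → χ x * H t)                  ≡⟨ ∑-*ʳ (H t) L χ ⟩
      ∑ L χ * H t                            ≤⟨ *-monoˡ-≤ (H t) (h χ) ⟩
      d χ * H t                              ∎
      where
      picks-mono : ∀ L → All (λ (_ , L′) → ∀ χ → ∑ L′ χ ≤ ∑ L χ) (picks L)
      picks-mono L = All.tabulate λ i χ → ≤-trans (m≤n+m _ (χ _)) (≤-reflexive (All.lookup (picks-∑ χ L) i))

  -- Permanents as sums over arrangements of the columns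

  arrangements : ∀ r → List A → List (Vec A r)
  arrangements zero    L = [] ∷ []
  arrangements (suc r) L = concatMap (λ (x , L′) → map (x ∷_) (arrangements r L′)) (picks L)

  weight : ∀ {r} → Vec (A → ℕ) r → Vec A r → ℕ
  weight []       []      = 1
  weight (w ∷ ws) (x ∷ σ) = w x * weight ws σ

  ∑-arrangements : ∀ {r} (ws : Vec (A → ℕ) r) L → ∑ (arrangements r L) (weight ws) ≡ permanent (Vec.toList ws) L
  ∑-arrangements []       L = refl
  ∑-arrangements {r = suc r} (w ∷ ws) L = trans (∑-concatMap (picks L) _ _) (∑-cong (picks L) λ (x , L′) →
    trans (∑-map (arrangements r L′) _ _) (trans (∑-*ˡ (w x) (arrangements r L′) _) (cong (w x *_) (∑-arrangements ws L′))))

  -- Binomial ratios and counting supergraphs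

  choose-absorb : ∀ b q → suc q * suc b choose suc q ≡ suc b * b choose q
  choose-absorb b       zero    = trans (*-identityˡ (suc b choose 1)) (trans (nC1≡n (suc b)) (sym (*-identityʳ (suc b))))
  choose-absorb zero    (suc q) = trans (cong (suc (suc q) *_) (sym (nCk+nC[k+1]≡[n+1]C[k+1] 0 (suc q)))) (*-zeroʳ (suc (suc q)))
  choose-absorb (suc b) (suc q) = begin
    suc (suc q) * suc (suc b) choose suc (suc q)
      ≡⟨ cong (suc (suc q) *_) (nCk+nC[k+1]≡[n+1]C[k+1] (suc b) (suc q)) ⟨
    suc (suc q) * (suc b choose suc q + suc b choose suc (suc q))
      ≡⟨ lemma₁ q (suc b choose suc q) (suc b choose suc (suc q)) ⟩
    suc b choose suc q + (suc q * suc b choose suc q + suc (suc q) * suc b choose suc (suc q))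
      ≡⟨ cong (suc b choose suc q +_) (cong₂ _+_ (choose-absorb b q) (choose-absorb b (suc q))) ⟩
    suc b choose suc q + (suc b * b choose q + suc b * b choose suc q)
      ≡⟨ cong (suc b choose suc q +_) (*-distribˡ-+ (suc b) (b choose q) _) ⟨
    suc b choose suc q + suc b * (b choose q + b choose suc q)
      ≡⟨ cong (λ v → suc b choose suc q + suc b * v) (nCk+nC[k+1]≡[n+1]C[k+1] b q) ⟩
    suc (suc b) * suc b choose suc q  ∎
    where
    open ≡-Reasoning
    lemma₁ : ∀ q x y → suc (suc q) * (x + y) ≡ x + (suc q * x + suc (suc q) * y)
    lemma₁ = solve-∀

  -- The ratio of `b choose q` to `suc b choose q` is 1 - q / (b + 1), here without subtraction. The
  -- estimates below multiply such ratios.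
  choose-suc : ∀ b q → suc b * b choose q + q * suc b choose q ≡ suc b * suc b choose q
  choose-suc b zero    = +-identityʳ _
  choose-suc b (suc q) = begin
    suc b * b choose suc q + suc q * suc b choose suc q
      ≡⟨ cong (suc b * b choose suc q +_) (choose-absorb b q) ⟩
    suc b * b choose suc q + suc b * b choose q
      ≡⟨ lemma (suc b) (b choose suc q) (b choose q) ⟩
    suc b * (b choose q + b choose suc q)
      ≡⟨ cong (suc b *_) (nCk+nC[k+1]≡[n+1]C[k+1] b q) ⟩
    suc b * suc b choose suc q  ∎
    where
    open ≡-Reasoning
    lemma : ∀ s x y → s * x + s * y ≡ s * (y + x)
    lemma = solve-∀

  choose-ratio-upper : ∀ b q p → suc b ≤ p + q → (p + q) * b choose q ≤ p * suc b choose q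
  choose-ratio-upper b q p h = *-cancelˡ-≤ (suc b) (+-cancelʳ-≤ ((p + q) * (q * c′)) _ _ (begin
    suc b * ((p + q) * c) + (p + q) * (q * c′)    ≡⟨ lemma₁ (suc b) (p + q) c q c′ ⟩
    (p + q) * (suc b * c + q * c′)                ≡⟨ cong ((p + q) *_) (choose-suc b q) ⟩
    (p + q) * (suc b * c′)                        ≡⟨ lemma₂ p q (suc b) c′ ⟩
    suc b * (p * c′) + suc b * (q * c′)           ≤⟨ +-monoʳ-≤ _ (*-monoˡ-≤ (q * c′) h) ⟩
    suc b * (p * c′) + (p + q) * (q * c′)         ∎))
    where
    open ≤-Reasoning
    c c′ : ℕ
    c  = b choose q
    c′ = suc b choose q
    lemma₁ : ∀ b t c q d → b * (t * c) + t * (q * d) ≡ t * (b * c + q * d)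
    lemma₁ = solve-∀
    lemma₂ : ∀ p q b d → (p + q) * (b * d) ≡ b * (p * d) + b * (q * d)
    lemma₂ = solve-∀

  choose-ratio-lower : ∀ b q p t → p + q ≤ suc b → suc b ≤ t → p * suc b choose q ≤ t * b choose q
  choose-ratio-lower b q p t h h′ = ≤-trans (+-cancelʳ-≤ (q * c′) _ _ (begin
    p * c′ + q * c′         ≡⟨ *-distribʳ-+ c′ p q ⟨
    (p + q) * c′            ≤⟨ *-monoˡ-≤ c′ h ⟩
    suc b * c′              ≡⟨ choose-suc b q ⟨
    suc b * c + q * c′      ∎)) (*-monoˡ-≤ c h′)
    where
    open ≤-Reasoning
    c c′ : ℕ
    c  = b choose q
    c′ = suc b choose q

  -- Each of the s ratios 1 - q / (b' + 1), with b' + 1 ≤ p + q, is at most p / (p + q). In the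
  -- application p = m - u and q = N - m, so p / (p + q) is the probability of one further edge
  -- given U ⊆ G, and s further edges cost at most its s-th power.
  choose-power-upper : ∀ b q p s → s + b ≤ p + q → b choose q * (p + q) ^ s ≤ p ^ s * (s + b) choose q
  choose-power-upper b q p zero    h = ≤-reflexive (*-comm (b choose q) 1)
  choose-power-upper b q p (suc s) h = begin
    b choose q * ((p + q) * (p + q) ^ s)    ≡⟨ lemma (b choose q) (p + q) ((p + q) ^ s) ⟩
    (p + q) * (b choose q * (p + q) ^ s)    ≤⟨ *-monoʳ-≤ (p + q) (choose-power-upper b q p s (≤-trans (n≤1+n _) h)) ⟩
    (p + q) * (p ^ s * (s + b) choose q)    ≡⟨ lemma′ (p + q) (p ^ s) ((s + b) choose q) ⟩
    p ^ s * ((p + q) * (s + b) choose q)    ≤⟨ *-monoʳ-≤ (p ^ s) (choose-ratio-upper (s + b) q p h) ⟩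
    p ^ s * (p * suc (s + b) choose q)      ≡⟨ lemma″ (p ^ s) p (suc (s + b) choose q) ⟩
    p * p ^ s * suc (s + b) choose q        ∎
    where
    open ≤-Reasoning
    lemma : ∀ c t u → c * (t * u) ≡ t * (c * u)
    lemma = solve-∀
    lemma′ : ∀ t u c → t * (u * c) ≡ u * (t * c)
    lemma′ = solve-∀
    lemma″ : ∀ u p c → u * (p * c) ≡ p * u * c
    lemma″ = solve-∀

  -- Each of the s ratios has numerator at least p and denominator at most t. This serves the lower
  -- bound on the first moment.
  choose-power-lower : ∀ b q p t s → p + q ≤ suc b → s + b ≤ t → p ^ s * (s + b) choose q ≤ t ^ s * b choose q
  choose-power-lower b q p t zero    h h′ = ≤-refl
  choose-power-lower b q p t (suc s) h h′ = begin
    p * p ^ s * suc (s + b) choose q      ≡⟨ lemma p (p ^ s) _ ⟩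
    p ^ s * (p * suc (s + b) choose q)    ≤⟨ *-monoʳ-≤ (p ^ s) (choose-ratio-lower (s + b) q p t (≤-trans h (s≤s (m≤n+m b s))) h′) ⟩
    p ^ s * (t * (s + b) choose q)        ≡⟨ lemma′ (p ^ s) t _ ⟩
    t * (p ^ s * (s + b) choose q)        ≤⟨ *-monoʳ-≤ t (choose-power-lower b q p t s h (≤-trans (n≤1+n _) h′)) ⟩
    t * (t ^ s * b choose q)              ≡⟨ *-assoc t (t ^ s) _ ⟨
    t * t ^ s * b choose q                ∎
    where
    open ≤-Reasoning
    lemma : ∀ p u c → p * u * c ≡ u * (p * c)
    lemma = solve-∀
    lemma′ : ∀ u t c → u * (t * c) ≡ t * (u * c)
    lemma′ = solve-∀

  𝟙 : Dec P → ℕ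
  𝟙 p? = if does p? then 1 else 0

  𝟙-cong : (p? : Dec P) (q? : Dec P′) → (P → P′) → (P′ → P) → 𝟙 p? ≡ 𝟙 q?
  𝟙-cong (yes _) (yes _) f g = refl
  𝟙-cong (yes p) (no ¬q) f g = contradiction (f p) ¬q
  𝟙-cong (no ¬p) (yes q) f g = contradiction (g q) ¬p
  𝟙-cong (no _)  (no _)  f g = refl

  𝟙-no : (p? : Dec P) → ¬ P → 𝟙 p? ≡ 0
  𝟙-no (yes p) ¬p = contradiction p ¬p
  𝟙-no (no _)  ¬p = refl

  𝟙-yes : (p? : Dec P) → P → 𝟙 p? ≡ 1
  𝟙-yes (yes _) p = refl
  𝟙-yes (no ¬p) p = contradiction p ¬p

  𝟙-× : (p? : Dec P) (q? : Dec P′) → 𝟙 (p? ×-dec q?) ≡ 𝟙 p? * 𝟙 q?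
  𝟙-× (yes _) q? = sym (*-identityˡ (𝟙 q?))
  𝟙-× (no _)  q? = refl

  ∑-filter : {R : A → Set} (R? : Decidable R) (xs : List A) (f : A → ℕ) →
    ∑ (filter R? xs) f ≡ ∑ xs (λ x → 𝟙 (R? x) * f x)
  ∑-filter R? []       f = refl
  ∑-filter R? (x ∷ xs) f with R? x
  ... | yes _ = cong₂ _+_ (sym (*-identityˡ (f x))) (∑-filter R? xs f)
  ... | no  _ = ∑-filter R? xs f

  length-filter : {R : A → Set} (R? : Decidable R) (xs : List A) → length (filter R? xs) ≡ ∑ xs (λ x → 𝟙 (R? x))
  length-filter R? []       = refl
  length-filter R? (x ∷ xs) with R? x
  ... | yes _ = cong suc (length-filter R? xs)
  ... | no  _ = length-filter R? xs

  -- The size is prescribed through the complement, so that no case |U| > m arises in the count.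
  supersets : ∀ {n} → Subset n → ℕ → ℕ
  supersets {n} U q = ∑ (allSubsets n) (λ G → 𝟙 (∣ ∁ G ∣ ≟ q) * 𝟙 (U ⊆? G))

  ∑-allSubsets-suc : ∀ n f → ∑ (allSubsets (suc n)) f ≡
    ∑ (allSubsets n) (λ G → f (outside ∷ G)) + ∑ (allSubsets n) (λ G → f (inside ∷ G))
  ∑-allSubsets-suc n f = trans (∑-++ (map (outside ∷_) (allSubsets n)) _ f)
    (cong₂ _+_ (∑-map (allSubsets n) _ f) (∑-map (allSubsets n) _ f))

  -- The complement of such a G is an arbitrary q-element subset of `∁ U`. A first coordinate
  -- outside U gives Pascal's rule; for one in U, the sets omitting it contribute nothing.
  supersets-choose : ∀ {n} (U : Subset n) q → supersets U q ≡ ∣ ∁ U ∣ choose q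
  supersets-choose {zero}  [] zero    = refl
  supersets-choose {zero}  [] (suc q) = refl
  supersets-choose {suc n} (inside ∷ U) q = trans (∑-allSubsets-suc n _) (trans
    (cong₂ _+_
      (trans (∑-cong (allSubsets n) λ G → trans (cong (𝟙 (suc ∣ ∁ G ∣ ≟ q) *_) (𝟙-no ((inside ∷ U) ⊆? (outside ∷ G)) λ h → case h)) (*-zeroʳ (𝟙 (suc ∣ ∁ G ∣ ≟ q))))
        (∑-0 (allSubsets n)))
      (∑-cong (allSubsets n) λ G → cong (𝟙 (∣ ∁ G ∣ ≟ q) *_) (𝟙-cong ((inside ∷ U) ⊆? (inside ∷ G)) (U ⊆? G) (λ h → drop-∷-⊆ h) (λ h → in⊆in h))))
    (supersets-choose U q))
    where
    case : ∀ {G : Subset n} → ¬ ((inside ∷ U) ⊆ (outside ∷ G))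
    case h with () ← h here
  supersets-choose {suc n} (outside ∷ U) zero = trans (∑-allSubsets-suc n _) (trans
    (cong₂ _+_
      (∑-0 (allSubsets n))
      (∑-cong (allSubsets n) λ G → cong (𝟙 (∣ ∁ G ∣ ≟ 0) *_) (𝟙-cong ((outside ∷ U) ⊆? (inside ∷ G)) (U ⊆? G) (λ h → drop-∷-⊆ h) (λ h → out⊆ h))))
    (supersets-choose U 0))
  supersets-choose {suc n} (outside ∷ U) (suc q) = trans (∑-allSubsets-suc n _) (trans
    (cong₂ _+_
      (∑-cong (allSubsets n) λ G → cong₂ _*_ (𝟙-cong (suc ∣ ∁ G ∣ ≟ suc q) (∣ ∁ G ∣ ≟ q) suc-injective (cong suc)) (𝟙-cong ((outside ∷ U) ⊆? (outside ∷ G)) (U ⊆? G) (λ h → drop-∷-⊆ h) (λ h → out⊆ h)))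
      (∑-cong (allSubsets n) λ G → cong (𝟙 (∣ ∁ G ∣ ≟ suc q) *_) (𝟙-cong ((outside ∷ U) ⊆? (inside ∷ G)) (U ⊆? G) (λ h → drop-∷-⊆ h) (λ h → out⊆ h))))
    (trans (cong₂ _+_ (supersets-choose U q) (supersets-choose U (suc q))) (nCk+nC[k+1]≡[n+1]C[k+1] ∣ ∁ U ∣ q)))

  ∣∁p∣+∣p∣≡n : ∀ {n} (p : Subset n) → ∣ ∁ p ∣ + ∣ p ∣ ≡ n
  ∣∁p∣+∣p∣≡n p = trans (cong (_+ ∣ p ∣) (∣∁p∣≡n∸∣p∣ p)) (m∸n+n≡m (∣p∣≤n p))

  ∑-graphs : ∀ n m q → q + m ≡ n * n → (U : BipGraph n) → ∑ (graphs n m) (λ G → 𝟙 (U ⊆? G)) ≡ ∣ ∁ U ∣ choose q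
  ∑-graphs n m q eq U = trans (∑-filter (λ G → ∣ G ∣ ≟ m) (allSubsets (n * n)) (λ G → 𝟙 (U ⊆? G)))
    (trans (∑-cong (allSubsets (n * n)) λ G → cong (_* 𝟙 (U ⊆? G)) (𝟙-cong (∣ G ∣ ≟ m) (∣ ∁ G ∣ ≟ q)
        (λ { refl → +-cancelʳ-≡ m _ _ (trans (∣∁p∣+∣p∣≡n G) (sym eq)) })
        (λ { refl → +-cancelˡ-≡ q _ _ (trans (∣∁p∣+∣p∣≡n G) (sym eq)) })))
      (supersets-choose U q))

  perfectMatchings : ∀ n → List (BipGraph n)
  perfectMatchings n = filter (isPerfectMatching? n) (allSubsets (n * n))

  #perfectMatchings-∑ : ∀ n G → #perfectMatchings n G ≡ ∑ (perfectMatchings n) (λ M → 𝟙 (M ⊆? G))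
  #perfectMatchings-∑ n G = trans (length-filter _ (allSubsets (n * n)))
    (trans (∑-cong (allSubsets (n * n)) λ M → 𝟙-× (isPerfectMatching? n M) (M ⊆? G))
      (sym (∑-filter (isPerfectMatching? n) (allSubsets (n * n)) _)))

  𝟙-∪ : ∀ {n} (U M G : Subset n) → 𝟙 (U ⊆? G) * 𝟙 (M ⊆? G) ≡ 𝟙 ((U ∪ M) ⊆? G)
  𝟙-∪ U M G = trans (sym (𝟙-× (U ⊆? G) (M ⊆? G))) (𝟙-cong (U ⊆? G ×-dec M ⊆? G) ((U ∪ M) ⊆? G)
    (λ (h , h′) x∈ → [ h , h′ ] (x∈p∪q⁻ U M x∈))
    (λ h → (λ x∈ → h (p⊆p∪q M x∈)) , (λ x∈ → h (q⊆p∪q U M x∈))))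

  -- The expectation of X ^ k on the event U ⊆ G, times the number of graphs. A general U makes
  -- induction on k possible: one factor X becomes a sum over matchings M, and M is absorbed into U.
  moment : ∀ n m → BipGraph n → ℕ → ℕ
  moment n m U k = ∑ (graphs n m) (λ G → 𝟙 (U ⊆? G) * #perfectMatchings n G ^ k)

  moment-suc : ∀ n m U k → moment n m U (suc k) ≡ ∑ (perfectMatchings n) (λ M → moment n m (U ∪ M) k)
  moment-suc n m U k = begin
    ∑ 𝒢 (λ G → 𝟙 (U ⊆? G) * (X G * X G ^ k))
      ≡⟨ ∑-cong 𝒢 (λ G → cong (λ v → 𝟙 (U ⊆? G) * (v * X G ^ k)) (#perfectMatchings-∑ n G)) ⟩
    ∑ 𝒢 (λ G → 𝟙 (U ⊆? G) * (∑ 𝓜 (λ M → 𝟙 (M ⊆? G)) * X G ^ k))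
      ≡⟨ ∑-cong 𝒢 (λ G → trans (cong (𝟙 (U ⊆? G) *_) (sym (∑-*ʳ (X G ^ k) 𝓜 _))) (sym (∑-*ˡ (𝟙 (U ⊆? G)) 𝓜 _))) ⟩
    ∑ 𝒢 (λ G → ∑ 𝓜 (λ M → 𝟙 (U ⊆? G) * (𝟙 (M ⊆? G) * X G ^ k)))
      ≡⟨ ∑-swap 𝒢 𝓜 _ ⟩
    ∑ 𝓜 (λ M → ∑ 𝒢 (λ G → 𝟙 (U ⊆? G) * (𝟙 (M ⊆? G) * X G ^ k)))
      ≡⟨ ∑-cong 𝓜 (λ M → ∑-cong 𝒢 λ G → trans (sym (*-assoc (𝟙 (U ⊆? G)) (𝟙 (M ⊆? G)) _)) (cong (_* X G ^ k) (𝟙-∪ U M G))) ⟩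
    ∑ 𝓜 (λ M → moment n m (U ∪ M) k)  ∎
    where
    open ≡-Reasoning
    𝒢 = graphs n m
    𝓜 = perfectMatchings n
    X = #perfectMatchings n

  -- Perfect matchings as arrangements

  picks-↭ : {L : List A} {p : A × List A} → p ∈ picks L → L ↭ proj₁ p ∷ proj₂ p
  picks-↭ {L = x ∷ L} (here refl) = ↭-refl
  picks-↭ {L = x ∷ L} (there i) with (y , L′) , j , refl ← ∈-map⁻ _ i =
    ↭-trans (↭-prep x (picks-↭ j)) (↭-swap x y ↭-refl)

  ∈-picks : ∀ {x : A} {L} → x ∈ L → ∃[ L′ ] (x , L′) ∈ picks L
  ∈-picks (here refl)             = _ , here refl
  ∈-picks (there i) with L′ , j ← ∈-picks i = _ , there (∈-map⁺ _ j)

  arrangements-↭ : ∀ r {L : List A} {σ} → length L ≡ r → σ ∈ arrangements r L → L ↭ Vec.toList σ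
  arrangements-↭ zero {[]} eq (here refl) = ↭-refl
  arrangements-↭ (suc r) {L} eq i
    with _ , j , k ← ∈-concat⁻′ (map _ (picks L)) i
    with (x , L′) , l , refl ← ∈-map⁻ _ k
    with σ , m , refl ← ∈-map⁻ _ j
    = ↭-trans (picks-↭ l) (↭-prep x (arrangements-↭ r (suc-injective (trans (sym (↭-length (picks-↭ l))) eq)) m))

  ↭-arrangements : ∀ {r} {L : List A} (σ : Vec A r) → L ↭ Vec.toList σ → σ ∈ arrangements r L
  ↭-arrangements {L = []} []       L↭ = here refl
  ↭-arrangements {L = _ ∷ _} [] L↭ with () ← ↭-length L↭
  ↭-arrangements {L = L} (x ∷ σ) L↭
    with L′ , i ← ∈-picks (∈-resp-↭ (↭-sym L↭) (here refl))
    = ∈-concat⁺′ (∈-map⁺ (x ∷_) (↭-arrangements σ (drop-∷ (↭-trans (↭-sym (picks-↭ i)) L↭)))) (∈-map⁺ _ i)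

  Unique-↭ : {L L′ : List A} → L ↭ L′ → Unique L → Unique L′
  Unique-↭ p = ↭ₛ.Unique-resp-↭ (setoid _) (↭⇒↭ₛ p)

  map-proj₁-picks : (L : List A) → map proj₁ (picks L) ≡ L
  map-proj₁-picks []      = refl
  map-proj₁-picks (x ∷ L) = cong (x ∷_) (trans (sym (map-∘ (picks L))) (map-proj₁-picks L))

  Unique-arrangements : ∀ r {L : List A} → Unique L → Unique (arrangements r L)
  Unique-arrangements zero    u = [] ∷ []
  Unique-arrangements (suc r) {L} u = Unique.concat⁺
    (All.map⁺ (All.tabulate λ {(x , L′)} i → Unique.map⁺ (cong Vec.tail)
      (Unique-arrangements r (AllPairs.tail (Unique-↭ (picks-↭ i) u)))))
    (AllPairs.map⁺ (AllPairs.map disjoint (AllPairs.map⁻ (subst Unique (sym (map-proj₁-picks L)) u))))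
    where
    extend : A × List A → List (Vec A (suc r))
    extend (x , L′) = map (x ∷_) (arrangements r L′)
    disjoint : ∀ {p q} → proj₁ p ≢ proj₁ q → Disjoint (extend p) (extend q)
    disjoint x≢y (i , j) with _ , _ , refl ← ∈-map⁻ _ i with _ , _ , refl ← ∈-map⁻ _ j = x≢y refl

  ∈-allSubsets : ∀ {n} (U : Subset n) → U ∈ allSubsets n
  ∈-allSubsets []            = here refl
  ∈-allSubsets (outside ∷ U) = ∈-++⁺ˡ (∈-map⁺ _ (∈-allSubsets U))
  ∈-allSubsets (inside ∷ U)  = ∈-++⁺ʳ (map _ (allSubsets _)) (∈-map⁺ _ (∈-allSubsets U))

  Unique-allSubsets : ∀ n → Unique (allSubsets n)
  Unique-allSubsets zero    = [] ∷ []
  Unique-allSubsets (suc n) = Unique.++⁺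
    (Unique.map⁺ (cong Vec.tail) (Unique-allSubsets n))
    (Unique.map⁺ (cong Vec.tail) (Unique-allSubsets n))
    disjoint
    where
    disjoint : Disjoint (map (outside ∷_) (allSubsets n)) (map (inside ∷_) (allSubsets n))
    disjoint (i , j) with _ , _ , refl ← ∈-map⁻ _ i with () ← ∈-map⁻ _ j .proj₂ .proj₂

  -- Concatenating rows of length n numbers the pairs exactly as `combine` does, so the blocks are
  -- the neighbourhoods of the left vertices.
  graph : ∀ {n r} → Vec (Fin n) r → Subset (r * n)
  graph σ = Vec.concat (Vec.map ⁅_⁆ σ)

  lookup-graph : ∀ {n r} (σ : Vec (Fin n) r) i j → lookup (graph σ) (combine i j) ≡ lookup ⁅ lookup σ i ⁆ j
  lookup-graph σ i j = trans (lookup-concat (Vec.map ⁅_⁆ σ) i j) (cong (λ R → lookup R j) (lookup-map i ⁅_⁆ σ))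

  Adj-graph⁺ : ∀ {n} (σ : Vec (Fin n) n) {i j} → lookup σ i ≡ j → Adj n (graph σ) i j
  Adj-graph⁺ σ {i} refl = lookup⇒[]= _ (graph σ) (trans (lookup-graph σ i (lookup σ i)) ([]=⇒lookup (x∈⁅x⁆ (lookup σ i))))

  Adj-graph⁻ : ∀ {n} (σ : Vec (Fin n) n) {i j} → Adj n (graph σ) i j → lookup σ i ≡ j
  Adj-graph⁻ σ {i} {j} a = sym (x∈⁅y⁆⇒x≡y (lookup σ i) (lookup⇒[]= j _ (trans (sym (lookup-graph σ i j)) ([]=⇒lookup a))))

  lookup-ext : ∀ {r} {σ τ : Vec A r} → (∀ i → lookup σ i ≡ lookup τ i) → σ ≡ τ
  lookup-ext {σ = σ} {τ} h = trans (sym (tabulate∘lookup σ)) (trans (tabulate-cong h) (tabulate∘lookup τ))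

  graph-injective : ∀ {n} {σ τ : Vec (Fin n) n} → graph σ ≡ graph τ → σ ≡ τ
  graph-injective {n} {σ} {τ} eq = lookup-ext λ i →
    sym (Adj-graph⁻ τ (subst (λ G → Adj n G i (lookup σ i)) eq (Adj-graph⁺ σ refl)))

  lookup-toList : ∀ {r} (σ : Vec A r) {x} → x ∈ Vec.toList σ → ∃[ i ] lookup σ i ≡ x
  lookup-toList σ x∈ = VecAny.index (∈-toList⁻ x∈) , sym (lookup-index (∈-toList⁻ x∈))

  lookup-injective : ∀ {r} (σ : Vec A r) → Unique (Vec.toList σ) → ∀ i j → lookup σ i ≡ lookup σ j → i ≡ j
  lookup-injective (x ∷ σ) u        zero    zero    eq = refl
  lookup-injective (x ∷ σ) (x∉ ∷ u) zero    (suc j) eq = contradiction eq (All.lookup x∉ (∈-toList⁺ (∈-lookup j σ)))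
  lookup-injective (x ∷ σ) (x∉ ∷ u) (suc i) zero    eq = contradiction (sym eq) (All.lookup x∉ (∈-toList⁺ (∈-lookup i σ)))
  lookup-injective (x ∷ σ) (_ ∷ u)  (suc i) (suc j) eq = cong suc (lookup-injective σ u i j eq)

  toList-tabulate : ∀ {r} (f : Fin r → A) → Vec.toList (Vec.tabulate f) ≡ tabulate f
  toList-tabulate {r = zero}  f = refl
  toList-tabulate {r = suc r} f = cong (f zero ∷_) (toList-tabulate (f ∘ suc))

  isPerfectMatching-graph : ∀ {n} {σ : Vec (Fin n) n} → allFin n ↭ Vec.toList σ → IsPerfectMatching n (graph σ)
  isPerfectMatching-graph {n} {σ} p =
    (λ i → lookup σ i , Adj-graph⁺ σ refl , Adj-graph⁻ σ) ,
    (λ j → let i , σi≡j = lookup-toList σ (∈-resp-↭ p (∈-allFin j)) in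
      i , Adj-graph⁺ σ σi≡j , λ a → lookup-injective σ (Unique-↭ p (Unique.allFin⁺ n)) _ _ (trans σi≡j (sym (Adj-graph⁻ σ a))))

  -- Uniqueness in the columns makes the map from a left vertex to its partner injective, and
  -- existence makes it surjective; its values thus list `Fin n` without repetition.
  isPerfectMatching⇒graph : ∀ {n} {M : BipGraph n} → IsPerfectMatching n M →
    ∃[ σ ] (allFin n ↭ Vec.toList σ × M ≡ graph σ)
  isPerfectMatching⇒graph {n} {M} (rows , cols) = σ , all↭σ , ⊆-antisym M⊆ ⊆M
    where
    f : Fin n → Fin n
    f i = rows i .proj₁
    f-adj : ∀ i → Adj n M i (f i)
    f-adj i = rows i .proj₂ .proj₁
    f-unique : ∀ {i j} → Adj n M i j → f i ≡ j
    f-unique {i} a = rows i .proj₂ .proj₂ a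
    σ : Vec (Fin n) n
    σ = Vec.tabulate f
    f-injective : ∀ {i j} → f i ≡ f j → i ≡ j
    f-injective {i} {j} eq with _ , _ , u ← cols (f j) =
      trans (sym (u (subst (Adj n M i) eq (f-adj i)))) (u (f-adj j))
    all↭σ : allFin n ↭ Vec.toList σ
    all↭σ = ∼bag⇒↭ (unique∧set⇒bag (Unique.allFin⁺ n)
      (subst Unique (sym (toList-tabulate f)) (Unique.tabulate⁺ f-injective))
      (λ {j} → mk⇔ (λ _ → let i , a , _ = cols j in
          subst (_∈ Vec.toList σ) (trans (lookup∘tabulate f i) (f-unique a)) (∈-toList⁺ (∈-lookup i σ)))
        (λ _ → ∈-allFin j)))
    M⊆ : M ⊆ graph σ
    M⊆ {e} e∈ with i , j , refl ← combine-surjective {n} {n} e =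
      Adj-graph⁺ σ (trans (lookup∘tabulate f i) (f-unique e∈))
    ⊆M : graph σ ⊆ M
    ⊆M {e} e∈ with i , j , refl ← combine-surjective {n} {n} e =
      subst (Adj n M i) (trans (sym (lookup∘tabulate f i)) (Adj-graph⁻ σ e∈)) (f-adj i)

  -- Both lists are free of duplicates and have the same members. Sums over matchings can thereby be
  -- read as permanents.
  perfectMatchings-↭ : ∀ n → perfectMatchings n ↭ map graph (arrangements n (allFin n))
  perfectMatchings-↭ n = ∼bag⇒↭ (unique∧set⇒bag
    (Unique.filter⁺ (isPerfectMatching? n) (Unique-allSubsets (n * n)))
    (Unique.map⁺ graph-injective (Unique-arrangements n (Unique.allFin⁺ n)))
    (λ {M} → mk⇔ to from))
    where
    to : ∀ {M} → M ∈ perfectMatchings n → M ∈ map graph (arrangements n (allFin n))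
    to M∈ with _ , pm ← ∈-filter⁻ (isPerfectMatching? n) {xs = allSubsets (n * n)} M∈
          with σ , p , refl ← isPerfectMatching⇒graph pm = ∈-map⁺ graph (↭-arrangements σ p)
    from : ∀ {M} → M ∈ map graph (arrangements n (allFin n)) → M ∈ perfectMatchings n
    from M∈ with σ , i , refl ← ∈-map⁻ _ M∈ =
      ∈-filter⁺ (isPerfectMatching? n) (∈-allSubsets (graph σ))
        (isPerfectMatching-graph (arrangements-↭ n (length-tabulate _) i))

  ∑-perfectMatchings : ∀ n F → ∑ (perfectMatchings n) F ≡ ∑ (arrangements n (allFin n)) (F ∘ graph)
  ∑-perfectMatchings n F = trans (sum-↭ (map⁺ F (perfectMatchings-↭ n))) (∑-map (arrangements n (allFin n)) graph F)

  -- Extending a graph by a perfect matching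

  indicator : ∀ {n} → Subset n → Fin n → ℕ
  indicator R j = if lookup R j then 1 else 0

  ∣p++q∣≡∣p∣+∣q∣ : ∀ {m n} (p : Subset m) (q : Subset n) → ∣ p Vec.++ q ∣ ≡ ∣ p ∣ + ∣ q ∣
  ∣p++q∣≡∣p∣+∣q∣ []            q = refl
  ∣p++q∣≡∣p∣+∣q∣ (inside  ∷ p) q = cong suc (∣p++q∣≡∣p∣+∣q∣ p q)
  ∣p++q∣≡∣p∣+∣q∣ (outside ∷ p) q = ∣p++q∣≡∣p∣+∣q∣ p q

  ∣p∪q∣≤∣p∣+∣q∣ : ∀ {n} (p q : Subset n) → ∣ p ∪ q ∣ ≤ ∣ p ∣ + ∣ q ∣
  ∣p∪q∣≤∣p∣+∣q∣ []            []            = z≤n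
  ∣p∪q∣≤∣p∣+∣q∣ (outside ∷ p) (outside ∷ q) = ∣p∪q∣≤∣p∣+∣q∣ p q
  ∣p∪q∣≤∣p∣+∣q∣ (outside ∷ p) (inside  ∷ q) = ≤-trans (s≤s (∣p∪q∣≤∣p∣+∣q∣ p q)) (≤-reflexive (sym (+-suc ∣ p ∣ ∣ q ∣)))
  ∣p∪q∣≤∣p∣+∣q∣ (inside  ∷ p) (outside ∷ q) = s≤s (∣p∪q∣≤∣p∣+∣q∣ p q)
  ∣p∪q∣≤∣p∣+∣q∣ (inside  ∷ p) (inside  ∷ q) = s≤s (≤-trans (∣p∪q∣≤∣p∣+∣q∣ p q) (+-monoʳ-≤ ∣ p ∣ (n≤1+n ∣ q ∣)))

  ∑-indicator : ∀ {n} (R : Subset n) → ∑ (allFin n) (indicator R) ≡ ∣ R ∣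
  ∑-indicator R = trans (cong sum (map-tabulate (λ i → i) (indicator R))) (go R)
    where
    go : ∀ {n} (R : Subset n) → sum (tabulate (indicator R)) ≡ ∣ R ∣
    go []            = refl
    go (inside  ∷ R) = cong suc (go R)
    go (outside ∷ R) = go R

  ∣∁[p∪⁅x⁆]∣ : ∀ {n} (R : Subset n) j → ∣ ∁ R ∣ + indicator R j ≡ suc ∣ ∁ (R ∪ ⁅ j ⁆) ∣
  ∣∁[p∪⁅x⁆]∣ (inside  ∷ R) zero = trans (+-comm _ 1) (cong (λ p → suc ∣ ∁ p ∣) (sym (∪-identityʳ R)))
  ∣∁[p∪⁅x⁆]∣ (outside ∷ R) zero = trans (+-identityʳ _) (cong (λ p → suc ∣ ∁ p ∣) (sym (∪-identityʳ R)))
  ∣∁[p∪⁅x⁆]∣ (inside  ∷ R) (suc j) = ∣∁[p∪⁅x⁆]∣ R j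
  ∣∁[p∪⁅x⁆]∣ (outside ∷ R) (suc j) = cong suc (∣∁[p∪⁅x⁆]∣ R j)

  ∣graph∣ : ∀ {n r} (σ : Vec (Fin n) r) → ∣ graph σ ∣ ≡ r
  ∣graph∣ []      = refl
  ∣graph∣ (x ∷ σ) = trans (∣p++q∣≡∣p∣+∣q∣ ⁅ x ⁆ (graph σ)) (cong₂ _+_ (∣⁅x⁆∣≡1 x) (∣graph∣ σ))

  -- For U with rows `Rs`, the numbers of edges of `graph σ` inside and outside U. Only the latter
  -- lower the probability of `graph σ` ⊆ G given U ⊆ G.
  hits misses : ∀ {n r} → Vec (Subset n) r → Vec (Fin n) r → ℕ
  hits   []       []      = 0
  hits   (R ∷ Rs) (x ∷ σ) = indicator R x + hits Rs σ
  misses []       []      = 0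
  misses (R ∷ Rs) (x ∷ σ) = (1 ∸ indicator R x) + misses Rs σ

  misses-∣∁∣ : ∀ {n r} (Rs : Vec (Subset n) r) σ →
    misses Rs σ + ∣ ∁ (Vec.concat Rs ∪ graph σ) ∣ ≡ ∣ ∁ (Vec.concat Rs) ∣
  misses-∣∁∣ []       []      = refl
  misses-∣∁∣ (R ∷ Rs) (x ∷ σ) = begin
    (1 ∸ indicator R x) + misses Rs σ + ∣ ∁ ((R Vec.++ U) ∪ (⁅ x ⁆ Vec.++ graph σ)) ∣
      ≡⟨ cong ((1 ∸ indicator R x) + misses Rs σ +_) (trans
           (cong (∣_∣ ∘ ∁) (zipWith-++ _ R U ⁅ x ⁆ (graph σ)))
           (∣∁[p++q]∣ (R ∪ ⁅ x ⁆) (U ∪ graph σ))) ⟩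
    (1 ∸ indicator R x) + misses Rs σ + (∣ ∁ (R ∪ ⁅ x ⁆) ∣ + ∣ ∁ (U ∪ graph σ) ∣)
      ≡⟨ lemma (1 ∸ indicator R x) (misses Rs σ) _ _ ⟩
    ((1 ∸ indicator R x) + ∣ ∁ (R ∪ ⁅ x ⁆) ∣) + (misses Rs σ + ∣ ∁ (U ∪ graph σ) ∣)
      ≡⟨ cong₂ _+_ (row-step R x) (misses-∣∁∣ Rs σ) ⟩
    ∣ ∁ R ∣ + ∣ ∁ U ∣
      ≡⟨ ∣∁[p++q]∣ R U ⟨
    ∣ ∁ (R Vec.++ U) ∣  ∎
    where
    open ≡-Reasoning
    U : Subset _
    U = Vec.concat Rs
    lemma : ∀ a b c d → a + b + (c + d) ≡ (a + c) + (b + d)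
    lemma = solve-∀
    ∣∁[p++q]∣ : ∀ {m n} (p : Subset m) (q : Subset n) → ∣ ∁ (p Vec.++ q) ∣ ≡ ∣ ∁ p ∣ + ∣ ∁ q ∣
    ∣∁[p++q]∣ p q = trans (cong ∣_∣ (Vec.map-++ _ p q)) (∣p++q∣≡∣p∣+∣q∣ (∁ p) (∁ q))
    row-step : ∀ {n} (R : Subset n) x → (1 ∸ indicator R x) + ∣ ∁ (R ∪ ⁅ x ⁆) ∣ ≡ ∣ ∁ R ∣
    row-step R x with lookup R x | ∣∁[p∪⁅x⁆]∣ R x
    ... | true  | eq = sym (suc-injective (trans (+-comm 1 _) eq))
    ... | false | eq = trans (sym eq) (+-identityʳ _)

  misses+hits : ∀ {n r} (Rs : Vec (Subset n) r) σ → misses Rs σ + hits Rs σ ≡ r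
  misses+hits []       []      = refl
  misses+hits (R ∷ Rs) (x ∷ σ) with lookup R x
  ... | true  = trans (+-suc _ _) (cong suc (misses+hits Rs σ))
  ... | false = cong suc (misses+hits Rs σ)

  -- With p = m - u and p + q = N - u this is the matrix A multiplied by p + q: entry p + q on U and
  -- p off U.
  rows : ∀ {n r} → ℕ → ℕ → Vec (Subset n) r → Vec (Fin n → ℕ) r
  rows p q Rs = Vec.map (row p q) (Vec.map indicator Rs)

  weight-rows : ∀ {n r} p q (Rs : Vec (Subset n) r) σ →
    weight (rows p q Rs) σ ≡ p ^ misses Rs σ * (p + q) ^ hits Rs σ
  weight-rows p q []       []      = refl
  weight-rows p q (R ∷ Rs) (x ∷ σ) with lookup R x
  ... | true  = trans (cong₂ _*_ (cong (p +_) (*-identityʳ q)) (weight-rows p q Rs σ)) (lemma (p + q) (p ^ misses Rs σ) _)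
    where
    lemma : ∀ t a b → t * (a * b) ≡ a * (t * b)
    lemma = solve-∀
  ... | false = trans (cong₂ _*_ (trans (cong (p +_) (*-zeroʳ q)) (+-identityʳ p)) (weight-rows p q Rs σ)) (sym (*-assoc p (p ^ misses Rs σ) _))

  -- The quotient of the two binomials is the probability of `graph σ` ⊆ G given U ⊆ G, at most p /
  -- (p + q) to the power `misses`. The hits contribute p + q on both sides and complete the
  -- exponent to r.
  choose-weight : ∀ {n r} p q (Rs : Vec (Subset n) r) σ → let U = Vec.concat Rs in ∣ ∁ U ∣ ≡ p + q →
    ∣ ∁ (U ∪ graph σ) ∣ choose q * (p + q) ^ r ≤ weight (rows p q Rs) σ * ∣ ∁ U ∣ choose q
  choose-weight {r = r} p q Rs σ eq = begin
    b choose q * t ^ r                                ≡⟨ cong (λ r → b choose q * t ^ r) (misses+hits Rs σ) ⟨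
    b choose q * t ^ (s + h)                          ≡⟨ cong (b choose q *_) (^-distribˡ-+-* t s h) ⟩
    b choose q * (t ^ s * t ^ h)                      ≡⟨ *-assoc (b choose q) (t ^ s) (t ^ h) ⟨
    b choose q * t ^ s * t ^ h                        ≤⟨ *-monoˡ-≤ (t ^ h) (choose-power-upper b q p s (≤-reflexive (trans (misses-∣∁∣ Rs σ) eq))) ⟩
    p ^ s * (s + b) choose q * t ^ h                  ≡⟨ lemma (p ^ s) ((s + b) choose q) (t ^ h) ⟩
    p ^ s * t ^ h * (s + b) choose q                  ≡⟨ cong₂ (λ v w → v * w choose q) (sym (weight-rows p q Rs σ)) (misses-∣∁∣ Rs σ) ⟩
    weight (rows p q Rs) σ * ∣ ∁ (Vec.concat Rs) ∣ choose q ∎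
    where
    open ≤-Reasoning
    b s h t : ℕ
    b = ∣ ∁ (Vec.concat Rs ∪ graph σ) ∣
    s = misses Rs σ
    h = hits Rs σ
    t = p + q
    lemma : ∀ a c d → a * c * d ≡ a * d * c
    lemma = solve-∀

  -- The row degrees of U add up to its number of edges, and Maclaurin's inequality replaces each by
  -- their mean; n ^ n clears the denominator n in the n operators.
  permanent-rows : ∀ {n} p q (Rs : Vec (Subset n) n) →
    n ^ n * permanent (Vec.toList (rows p q Rs)) (allFin n) ≤ shift^ (n * p) (q * ∣ Vec.concat Rs ∣) n _! 0
  permanent-rows {n} p q Rs = begin
    n ^ n * permanent (Vec.toList (rows p q Rs)) (allFin n)
      ≡⟨ cong (λ ws → n ^ n * permanent ws (allFin n)) ws≡ ⟩
    n ^ n * permanent (map (row p q) χs ++ []) (allFin n)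
      ≤⟨ *-monoʳ-≤ (n ^ n) (permanent-bound p q (∑ (allFin n)) χs 0 (allFin n)
           (trans (length-tabulate {n = n} _) (sym (trans (+-identityʳ _) |χs|))) λ _ → ≤-refl) ⟩
    n ^ n * shifts p zs _! 0
      ≡⟨ cong (λ l → l ^ l * shifts p zs _! 0) |zs| ⟨
    length zs ^ length zs * shifts p zs _! 0
      ≤⟨ shifts-maclaurin p zs _! 0 ⟩
    shift^ (length zs * p) (sum zs) (length zs) _! 0
      ≡⟨ cong₂ (λ l z → shift^ (l * p) z l _! 0) |zs| ∑zs ⟩
    shift^ (n * p) (q * ∣ Vec.concat Rs ∣) n _! 0  ∎
    where
    open ≤-Reasoning
    χs : List (Fin n → ℕ)
    χs = Vec.toList (Vec.map indicator Rs)
    zs : List ℕ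
    zs = map (λ χ → q * ∑ (allFin n) χ) χs
    ws≡ : Vec.toList (rows p q Rs) ≡ map (row p q) χs ++ []
    ws≡ = trans (toList-map (row p q) (Vec.map indicator Rs)) (sym (++-identityʳ _))
    |χs| : length χs ≡ n
    |χs| = length-toList (Vec.map indicator Rs)
    |zs| : length zs ≡ n
    |zs| = trans (length-map _ χs) |χs|
    ∑-degrees : ∀ {r} (Rs : Vec (Subset n) r) →
      ∑ (Vec.toList (Vec.map indicator Rs)) (∑ (allFin n)) ≡ ∣ Vec.concat Rs ∣
    ∑-degrees []       = refl
    ∑-degrees (R ∷ Rs) = trans (cong₂ _+_ (∑-indicator R) (∑-degrees Rs)) (sym (∣p++q∣≡∣p∣+∣q∣ R (Vec.concat Rs)))
    ∑zs : sum zs ≡ q * ∣ Vec.concat Rs ∣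
    ∑zs = trans (∑-*ˡ q χs (∑ (allFin n))) (cong (q *_) (∑-degrees Rs))

  permanent-rows-upper : ∀ {n} p q (Rs : Vec (Subset n) n) → .{{NonZero n}} → .{{NonZero p}} →
    let u = ∣ Vec.concat Rs ∣ in p + q + u ≡ n * n → u ≤ p → 2 * (n * (u * u)) ≤ p * p →
    (n * n) ^ n * permanent (Vec.toList (rows p q Rs)) (allFin n) ≤ 2 * (((p + u) * (p + q)) ^ n * n !)
  permanent-rows-upper {n} p q Rs N≡ u≤p 2nu²≤p² = begin
    (n * n) ^ n * W                              ≡⟨ cong (_* W) (^-distrib-* n n n) ⟩
    n ^ n * n ^ n * W                            ≡⟨ *-assoc (n ^ n) (n ^ n) W ⟩
    n ^ n * (n ^ n * W)                          ≤⟨ *-monoʳ-≤ (n ^ n) (permanent-rows p q Rs) ⟩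
    -- The remaining factor n ^ n turns the constant q u into n * c with c = q u, the form
    -- `shift^-!-upper` asks for.
    n ^ n * shift^ (n * p) c n _! 0              ≡⟨ shift^-scale n (n * p) c n _! 0 ⟨
    shift^ (n * (n * p)) (n * c) n _! 0          ≡⟨ cong (λ v → shift^ v (n * c) n _! 0) d+c≡ ⟨
    shift^ (d + c) (n * c) n _! 0                ≤⟨ shift^-!-upper d c n {{subst NonZero (sym d+c≡) (m*n≢0 n (n * p) {{it}} {{m*n≢0 n p}})}} bound ⟩
    2 * ((d + c + c) ^ n * n !)                  ≡⟨ cong (λ v → 2 * (v ^ n * n !)) sum≡ ⟩
    2 * (((p + u) * (p + q)) ^ n * n !)          ∎
    where
    open ≤-Reasoning
    u c d W : ℕ
    u = ∣ Vec.concat Rs ∣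
    c = q * u
    d = n * (n * p) ∸ c
    W = permanent (Vec.toList (rows p q Rs)) (allFin n)
    q≤N : q ≤ n * n
    q≤N = ≤-trans (≤-trans (m≤n+m q p) (m≤m+n (p + q) u)) (≤-reflexive N≡)
    c≤Nu : c ≤ n * n * u
    c≤Nu = *-monoˡ-≤ u q≤N
    d+c≡ : d + c ≡ n * (n * p)
    d+c≡ = m∸n+n≡m (≤-trans c≤Nu (≤-trans (*-monoʳ-≤ (n * n) u≤p) (≤-reflexive (*-assoc n n p))))
    lemma₁ : ∀ n N u → 2 * (n * (N * u * (N * u))) ≡ N * N * (2 * (n * (u * u)))
    lemma₁ = solve-∀
    lemma₂ : ∀ n p → n * n * (n * n) * (p * p) ≡ n * (n * p) * (n * (n * p))
    lemma₂ = solve-∀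
    bound : 2 * (n * (c * c)) ≤ (d + c) * (d + c)
    bound = begin
      2 * (n * (c * c))                            ≤⟨ *-monoʳ-≤ 2 (*-monoʳ-≤ n (*-mono-≤ c≤Nu c≤Nu)) ⟩
      2 * (n * (n * n * u * (n * n * u)))          ≡⟨ lemma₁ n (n * n) u ⟩
      n * n * (n * n) * (2 * (n * (u * u)))        ≤⟨ *-monoʳ-≤ (n * n * (n * n)) 2nu²≤p² ⟩
      n * n * (n * n) * (p * p)                    ≡⟨ lemma₂ n p ⟩
      n * (n * p) * (n * (n * p))                  ≡⟨ cong (λ v → v * v) d+c≡ ⟨
      (d + c) * (d + c)                            ∎
    -- Divided by N (p + q), with N = p + q + u and m = p + u, this is p' + z / n = m / N.
    lemma₃ : ∀ p q u → (p + q + u) * p + q * u ≡ (p + u) * (p + q)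
    lemma₃ = solve-∀
    sum≡ : d + c + c ≡ (p + u) * (p + q)
    sum≡ = trans (cong (_+ c) (trans d+c≡ (trans (sym (*-assoc n n p)) (cong (_* p) (sym N≡))))) (lemma₃ p q u)

  -- Summing `choose-weight` over all arrangements produces the permanent, and the n-th power of p +
  -- q that scales its matrix cancels. As a conditional expectation the result is E[X | U ⊆ G] ≤ 2
  -- n! (m / N)ⁿ, a bound from which U has disappeared.
  ∑-choose-upper : ∀ {n} p q (U : BipGraph n) → .{{NonZero n}} → .{{NonZero p}} →
    let u = ∣ U ∣ in p + q + u ≡ n * n → u ≤ p → 2 * (n * (u * u)) ≤ p * p →
    (n * n) ^ n * ∑ (perfectMatchings n) (λ M → ∣ ∁ (U ∪ M) ∣ choose q) ≤ 2 * ((p + u) ^ n * n !) * ∣ ∁ U ∣ choose q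
  ∑-choose-upper {n} p q U N≡ u≤p 2nu²≤p² with Rs , refl ← Vec.group n n U =
    *-cancelˡ-≤ ((p + q) ^ n) {{m^n≢0 (p + q) n {{ℕ.>-nonZero (≤-trans (ℕ.>-nonZero⁻¹ p) (m≤m+n p q))}}}} (begin
    t ^ n * (N ^ n * ∑ (perfectMatchings n) F)
      ≡⟨ cong (λ v → t ^ n * (N ^ n * v)) (∑-perfectMatchings n F) ⟩
    t ^ n * (N ^ n * ∑ arr (F ∘ graph))
      ≡⟨ lemma₁ (t ^ n) (N ^ n) _ ⟩
    N ^ n * (∑ arr (F ∘ graph) * t ^ n)
      ≡⟨ cong (N ^ n *_) (∑-*ʳ (t ^ n) arr (F ∘ graph)) ⟨
    N ^ n * ∑ arr (λ σ → F (graph σ) * t ^ n)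
      ≤⟨ *-monoʳ-≤ (N ^ n) (∑-mono (All.universal (λ σ → choose-weight p q Rs σ ∁U≡) arr)) ⟩
    N ^ n * ∑ arr (λ σ → weight (rows p q Rs) σ * g)
      ≡⟨ cong (N ^ n *_) (trans (∑-*ʳ g arr (weight (rows p q Rs))) (cong (_* g) (∑-arrangements (rows p q Rs) (allFin n)))) ⟩
    N ^ n * (permanent (Vec.toList (rows p q Rs)) (allFin n) * g)
      ≡⟨ *-assoc (N ^ n) _ g ⟨
    N ^ n * permanent (Vec.toList (rows p q Rs)) (allFin n) * g
      ≤⟨ *-monoˡ-≤ g (permanent-rows-upper p q Rs N≡ u≤p 2nu²≤p²) ⟩
    2 * (((p + u) * t) ^ n * n !) * g
      ≡⟨ cong (λ v → 2 * (v * n !) * g) (^-distrib-* (p + u) t n) ⟩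
    2 * ((p + u) ^ n * t ^ n * n !) * g
      ≡⟨ lemma₂ ((p + u) ^ n) (t ^ n) (n !) g ⟩
    t ^ n * (2 * ((p + u) ^ n * n !) * g)  ∎)
    where
    open ≤-Reasoning
    t u N g : ℕ
    t = p + q
    u = ∣ Vec.concat Rs ∣
    N = n * n
    g = ∣ ∁ (Vec.concat Rs) ∣ choose q
    arr = arrangements n (allFin n)
    F : BipGraph n → ℕ
    F M = ∣ ∁ (Vec.concat Rs ∪ M) ∣ choose q
    ∁U≡ : ∣ ∁ (Vec.concat Rs) ∣ ≡ p + q
    ∁U≡ = +-cancelʳ-≡ u _ _ (trans (∣∁p∣+∣p∣≡n (Vec.concat Rs)) (sym N≡))
    lemma₁ : ∀ a b s → a * (b * s) ≡ b * (s * a)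
    lemma₁ = solve-∀
    lemma₂ : ∀ a b f g → 2 * (a * b * f) * g ≡ b * (2 * (a * f) * g)
    lemma₂ = solve-∀

  -- Moments

  ∣perfectMatching∣ : ∀ n → All (λ M → ∣ M ∣ ≡ n) (perfectMatchings n)
  ∣perfectMatching∣ n = All.tabulate λ M∈ →
    let σ , _ , M≡ = isPerfectMatching⇒graph (∈-filter⁻ (isPerfectMatching? n) {xs = allSubsets (n * n)} M∈ .proj₂)
    in trans (cong ∣_∣ M≡) (∣graph∣ σ)

  length-perfectMatchings : ∀ n → ∑ (perfectMatchings n) (λ _ → 1) ≡ n !
  length-perfectMatchings n = begin
    ∑ (perfectMatchings n) (λ _ → 1)                ≡⟨ ∑-perfectMatchings n (λ _ → 1) ⟩
    ∑ (arrangements n (allFin n)) (λ _ → 1)         ≡⟨ ∑-cong (arrangements n (allFin n)) (λ σ → weight-ones σ) ⟨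
    ∑ (arrangements n (allFin n)) (weight ones)     ≡⟨ ∑-arrangements (ones {n}) (allFin n) ⟩
    permanent (Vec.toList (ones {n})) (allFin n)          ≡⟨ cong (λ ws → permanent ws (allFin n)) (toList-replicate n (const 1)) ⟩
    permanent (replicate n (const 1)) (allFin n)    ≡⟨ permanent-ones n (allFin n) (length-tabulate _) ⟩
    n !                                             ∎
    where
    open ≡-Reasoning
    ones : ∀ {r} → Vec (Fin n → ℕ) r
    ones = Vec.replicate _ (const 1)
    weight-ones : ∀ {r} (σ : Vec (Fin n) r) → weight ones σ ≡ 1
    weight-ones []      = refl
    weight-ones (x ∷ σ) = trans (*-identityˡ _) (weight-ones σ)

  -- Each step adds at most n edges to U and uses up one power of X, so |U| + k n never grows and
  -- `step` applies as long as a power is left. In the application b is the number of graphs and B a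
  -- constant times the total number of matchings.
  moment-bound : ∀ n m (g : BipGraph n → ℕ) b B K →
    (∀ U → moment n m U 0 ≡ g U) →
    (∀ U → ∣ U ∣ + n ≤ K * n → b * ∑ (perfectMatchings n) (λ M → g (U ∪ M)) ≤ B * g U) →
    ∀ k U → ∣ U ∣ + k * n ≤ K * n → b ^ k * moment n m U k ≤ B ^ k * g U
  moment-bound n m g b B K base step zero    U h = *-monoʳ-≤ 1 (≤-reflexive (base U))
  moment-bound n m g b B K base step (suc k) U h = begin
    b * b ^ k * moment n m U (suc k)
      ≡⟨ cong (b * b ^ k *_) (moment-suc n m U k) ⟩
    b * b ^ k * ∑ 𝓜 (λ M → moment n m (U ∪ M) k)
      ≡⟨ trans (*-assoc b (b ^ k) _) (cong (b *_) (sym (∑-*ˡ (b ^ k) 𝓜 _))) ⟩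
    b * ∑ 𝓜 (λ M → b ^ k * moment n m (U ∪ M) k)
      ≤⟨ *-monoʳ-≤ b (∑-mono (All.map (λ {M} |M|≡n → moment-bound n m g b B K base step k (U ∪ M) (size M |M|≡n)) (∣perfectMatching∣ n))) ⟩
    b * ∑ 𝓜 (λ M → B ^ k * g (U ∪ M))
      ≡⟨ trans (cong (b *_) (∑-*ˡ (B ^ k) 𝓜 _)) (lemma b (B ^ k) _) ⟩
    B ^ k * (b * ∑ 𝓜 (λ M → g (U ∪ M)))
      ≤⟨ *-monoʳ-≤ (B ^ k) (step U (≤-trans (+-monoʳ-≤ ∣ U ∣ (m≤m+n n (k * n))) h)) ⟩
    B ^ k * (B * g U)
      ≡⟨ lemma′ (B ^ k) B (g U) ⟩
    B * B ^ k * g U  ∎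
    where
    open ≤-Reasoning
    𝓜 = perfectMatchings n
    lemma : ∀ b c s → b * (c * s) ≡ c * (b * s)
    lemma = solve-∀
    lemma′ : ∀ c b g → c * (b * g) ≡ b * c * g
    lemma′ = solve-∀
    size : ∀ M → ∣ M ∣ ≡ n → ∣ U ∪ M ∣ + k * n ≤ K * n
    size M |M|≡n = ≤-trans (+-monoˡ-≤ (k * n) (≤-trans (∣p∪q∣≤∣p∣+∣q∣ U M) (≤-reflexive (cong (∣ U ∣ +_) |M|≡n))))
      (≤-trans (≤-reflexive (+-assoc ∣ U ∣ n (k * n))) h)

  moment-0 : ∀ n m q → q + m ≡ n * n → ∀ U → moment n m U 0 ≡ ∣ ∁ U ∣ choose q
  moment-0 n m q eq U = trans (∑-cong (graphs n m) λ G → *-identityʳ (𝟙 (U ⊆? G))) (∑-graphs n m q eq U)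

  moment-⊥ : ∀ n m k → moment n m ⊥ k ≡ ∑ (graphs n m) (λ G → #perfectMatchings n G ^ k)
  moment-⊥ n m k = ∑-cong (graphs n m) λ G → trans
    (cong (_* #perfectMatchings n G ^ k) (𝟙-yes (⊥ ⊆? G) ⊥⊆)) (*-identityˡ _)

  ∣∁⊥∣≡n : ∀ n → ∣ ∁ (⊥ {n = n}) ∣ ≡ n
  ∣∁⊥∣≡n n = trans (sym (+-identityʳ _)) (trans (cong (∣ ∁ (⊥ {n = n}) ∣ +_) (sym (∣⊥∣≡0 n))) (∣∁p∣+∣p∣≡n (⊥ {n = n})))

  length-graphs : ∀ n m q → q + m ≡ n * n → length (graphs n m) ≡ (n * n) choose q
  length-graphs n m q eq = begin
    length (graphs n m)                ≡⟨ *-identityʳ _ ⟨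
    length (graphs n m) * 1            ≡⟨ ∑-const (graphs n m) 1 ⟨
    ∑ (graphs n m) (λ _ → 1)           ≡⟨ moment-⊥ n m 0 ⟨
    moment n m ⊥ 0                     ≡⟨ moment-0 n m q eq ⊥ ⟩
    ∣ ∁ (⊥ {n = n * n}) ∣ choose q     ≡⟨ cong (_choose q) (∣∁⊥∣≡n (n * n)) ⟩
    (n * n) choose q                   ∎
    where
    open ≡-Reasoning

  -- The first moment and the ratio of the moments

  totalMatchings : ∀ n → ℕ → ℕ
  totalMatchings n m = ∑ (graphs n m) (#perfectMatchings n)

  totalMatchings-choose : ∀ n m q → q + m ≡ n * n → totalMatchings n m ≡ n ! * (n * n ∸ n) choose q
  totalMatchings-choose n m q eq = begin
    ∑ (graphs n m) (#perfectMatchings n)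
      ≡⟨ ∑-cong (graphs n m) (λ G → *-identityʳ (#perfectMatchings n G)) ⟨
    ∑ (graphs n m) (λ G → #perfectMatchings n G ^ 1)
      ≡⟨ moment-⊥ n m 1 ⟨
    moment n m ⊥ 1
      ≡⟨ moment-suc n m ⊥ 0 ⟩
    ∑ 𝓜 (λ M → moment n m (⊥ ∪ M) 0)
      ≡⟨ ∑-cong 𝓜 (λ M → trans (moment-0 n m q eq (⊥ ∪ M)) (cong (λ p → ∣ ∁ p ∣ choose q) (∪-identityˡ M))) ⟩
    ∑ 𝓜 (λ M → ∣ ∁ M ∣ choose q)
      ≡⟨ ∑-cong-All (All.map (λ {M} → ∣∁M∣ M) (∣perfectMatching∣ n)) ⟩
    ∑ 𝓜 (λ M → 1 * (n * n ∸ n) choose q)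
      ≡⟨ ∑-*ʳ ((n * n ∸ n) choose q) 𝓜 (λ _ → 1) ⟩
    ∑ 𝓜 (λ M → 1) * (n * n ∸ n) choose q
      ≡⟨ cong (_* (n * n ∸ n) choose q) (length-perfectMatchings n) ⟩
    n ! * (n * n ∸ n) choose q  ∎
    where
    open ≡-Reasoning
    𝓜 = perfectMatchings n
    ∣∁M∣ : ∀ (M : BipGraph n) → ∣ M ∣ ≡ n → ∣ ∁ M ∣ choose q ≡ 1 * (n * n ∸ n) choose q
    ∣∁M∣ M |M|≡n = trans (cong (_choose q) (trans (sym (m+n∸n≡m ∣ ∁ M ∣ n))
      (cong (_∸ n) (trans (cong (∣ ∁ M ∣ +_) (sym |M|≡n)) (∣∁p∣+∣p∣≡n M))))) (sym (*-identityˡ _))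

  -- Bernoulli's inequality gives m ^ l ≤ 2 (m - n) ^ l for l = n / 2a, and n ≤ 4al.
  power-loss : ∀ n m a → .{{NonZero n}} → .{{NonZero a}} → n * n ≤ a * m → 2 * a ≤ n →
    ∃[ r ] (r + n ≡ m × m ^ n ≤ 2 ^ (4 * a) * r ^ n)
  -- The exponent n is padded to n + e = 4 a l so that the bound on m ^ l can be raised to the power
  -- 4 a; the surplus cancels because r ^ e ≤ m ^ e.
  power-loss n m a n²≤am 2a≤n = r , r+n≡m , *-cancelʳ-≤ (m ^ n) (2 ^ (4 * a) * r ^ n) (r ^ e) {{m^n≢0 r e {{ℕ.>-nonZero r>0}}}} (begin
    m ^ n * r ^ e                            ≤⟨ *-monoʳ-≤ (m ^ n) (^-monoˡ-≤ e (≤-trans (m≤m+n r n) (≤-reflexive r+n≡m))) ⟩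
    m ^ n * m ^ e                            ≡⟨ ^-distribˡ-+-* m n e ⟨
    m ^ (n + e)                              ≡⟨ cong (m ^_) n+e≡ ⟩
    m ^ (l * (4 * a))                        ≡⟨ ^-*-assoc m l (4 * a) ⟨
    (m ^ l) ^ (4 * a)                        ≤⟨ ^-monoˡ-≤ (4 * a) m^l≤ ⟩
    (2 * r ^ l) ^ (4 * a)                    ≡⟨ ^-distrib-* 2 (r ^ l) (4 * a) ⟩
    2 ^ (4 * a) * (r ^ l) ^ (4 * a)          ≡⟨ cong (2 ^ (4 * a) *_) (^-*-assoc r l (4 * a)) ⟩
    2 ^ (4 * a) * r ^ (l * (4 * a))          ≡⟨ cong (λ v → 2 ^ (4 * a) * r ^ v) n+e≡ ⟨
    2 ^ (4 * a) * r ^ (n + e)                ≡⟨ cong (2 ^ (4 * a) *_) (^-distribˡ-+-* r n e) ⟩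
    2 ^ (4 * a) * (r ^ n * r ^ e)            ≡⟨ *-assoc (2 ^ (4 * a)) (r ^ n) (r ^ e) ⟨
    2 ^ (4 * a) * r ^ n * r ^ e              ∎)
    where
    open ≤-Reasoning
    instance
      2a≢0 : NonZero (2 * a)
      2a≢0 = m*n≢0 2 a
    l r e : ℕ
    l = n / (2 * a)
    r = m ∸ n
    e = l * (4 * a) ∸ n
    n<2a+2al : n < 2 * a + l * (2 * a)
    n<2a+2al = ≤-trans (s≤s (≤-reflexive (m≡m%n+[m/n]*n n (2 * a)))) (+-monoˡ-≤ (l * (2 * a)) (m%n<n n (2 * a)))
    -- With l ≥ 1 the rounding is harmless: n < 2 a (l + 1) ≤ 4 a l, the origin of the exponent 4 a.
    1≤l : 1 ≤ l
    1≤l = n≢0⇒n>0 λ l≡0 → <⇒≱ n<2a+2al (≤-trans (≤-reflexive (trans (cong (λ v → 2 * a + v * (2 * a)) l≡0) (+-identityʳ (2 * a)))) 2a≤n)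
    n≤4al : n ≤ l * (4 * a)
    n≤4al = begin
      n                                ≤⟨ <⇒≤ n<2a+2al ⟩
      2 * a + l * (2 * a)              ≡⟨ cong (_+ l * (2 * a)) (*-identityˡ (2 * a)) ⟨
      1 * (2 * a) + l * (2 * a)        ≤⟨ +-monoˡ-≤ _ (*-monoˡ-≤ (2 * a) 1≤l) ⟩
      l * (2 * a) + l * (2 * a)        ≡⟨ lemma l a ⟩
      l * (4 * a)                      ∎
      where
      lemma : ∀ l a → l * (2 * a) + l * (2 * a) ≡ l * (4 * a)
      lemma = solve-∀
    n+e≡ : n + e ≡ l * (4 * a)
    n+e≡ = m+[n∸m]≡n n≤4al
    2ln≤m : 2 * (l * n) ≤ m
    2ln≤m = *-cancelˡ-≤ a (begin
      a * (2 * (l * n))                ≡⟨ lemma a l n ⟩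
      l * (2 * a) * n                  ≤⟨ *-monoˡ-≤ n (m/n*n≤m n (2 * a)) ⟩
      n * n                            ≤⟨ n²≤am ⟩
      a * m                            ∎)
      where
      lemma : ∀ a l n → a * (2 * (l * n)) ≡ l * (2 * a) * n
      lemma = solve-∀
    2n≤m : n + n ≤ m
    2n≤m = begin
      n + n                 ≡⟨ lemma n ⟩
      2 * (1 * n)           ≤⟨ *-monoʳ-≤ 2 (*-monoˡ-≤ n 1≤l) ⟩
      2 * (l * n)           ≤⟨ 2ln≤m ⟩
      m                     ∎
      where
      lemma : ∀ n → n + n ≡ 2 * (1 * n)
      lemma = solve-∀
    r+n≡m : r + n ≡ m
    r+n≡m = m∸n+n≡m (≤-trans (m≤m+n n n) 2n≤m)
    r>0 : 0 < r
    r>0 = ≤-trans (ℕ.>-nonZero⁻¹ n) (+-cancelʳ-≤ n n r (≤-trans 2n≤m (≤-reflexive (sym r+n≡m))))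
    m^l≤ : m ^ l ≤ 2 * r ^ l
    m^l≤ = subst (λ v → v ^ l ≤ 2 * r ^ l) r+n≡m
      (^-half r n l {{ℕ.>-nonZero (≤-trans r>0 (m≤m+n r n))}} (≤-trans 2ln≤m (≤-reflexive (sym r+n≡m))))

  -- E[X] is n! times the quotient of `(N ∸ n) choose q` by `N choose q`, a product of n ratios that
  -- are each at least (m - n) / N. The hypothesis on r = m - n then restores (m / N)ⁿ up to the
  -- factor c.
  totalMatchings-lower : ∀ n m q c r → .{{NonZero n}} → q + m ≡ n * n → r + n ≡ m → m ^ n ≤ c * r ^ n →
    m ^ n * n ! * (n * n) choose q ≤ c * ((n * n) ^ n * totalMatchings n m)
  totalMatchings-lower n m q c r eq r+n≡m m^n≤ = begin
    m ^ n * n ! * N choose q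
      ≤⟨ *-monoˡ-≤ (N choose q) (*-monoˡ-≤ (n !) m^n≤) ⟩
    c * r ^ n * n ! * N choose q
      ≡⟨ lemma₁ c (r ^ n) (n !) (N choose q) ⟩
    c * (n ! * (r ^ n * N choose q))
      ≡⟨ cong (λ v → c * (n ! * (r ^ n * v choose q))) n+b≡N ⟨
    c * (n ! * (r ^ n * (n + b) choose q))
      ≤⟨ *-monoʳ-≤ c (*-monoʳ-≤ (n !)
           (choose-power-lower b q r N n (≤-trans (≤-reflexive r+q≡b) (n≤1+n b)) (≤-reflexive n+b≡N))) ⟩
    c * (n ! * (N ^ n * b choose q))
      ≡⟨ cong (c *_) (lemma₂ (n !) (N ^ n) (b choose q)) ⟩
    c * (N ^ n * (n ! * b choose q))
      ≡⟨ cong (λ v → c * (N ^ n * v)) (totalMatchings-choose n m q eq) ⟨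
    c * (N ^ n * totalMatchings n m)  ∎
    where
    open ≤-Reasoning
    N b : ℕ
    N = n * n
    b = N ∸ n
    n+b≡N : n + b ≡ N
    n+b≡N = m+[n∸m]≡n (m≤m*n n n)
    r+q≡b : r + q ≡ b
    r+q≡b = +-cancelˡ-≡ n _ _ (trans (lemma₀ n r q) (trans (cong (q +_) r+n≡m) (trans eq (sym n+b≡N))))
      where
      lemma₀ : ∀ n r q → n + (r + q) ≡ q + (r + n)
      lemma₀ = solve-∀
    lemma₁ : ∀ c r f g → c * r * f * g ≡ c * (f * (r * g))
    lemma₁ = solve-∀
    lemma₂ : ∀ f t g → f * (t * g) ≡ t * (f * g)
    lemma₂ = solve-∀

  -- From u ≤ m / 2 follows p ≥ m / 2 ≥ n² / (2 a), so p² ≥ n⁴ / (4 a²), whereas 2 n u² ≤ 2 K² n³.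
  -- Comparing the two gives the condition 8 (a K)² ≤ n.
  union-sparse : ∀ n m a K u → .{{NonZero n}} → .{{NonZero a}} →
    n * n ≤ a * m → 2 * (a * K) ≤ n → 8 * (a * K * (a * K)) ≤ n → u ≤ K * n →
    ∃[ p ] (p + u ≡ m × 0 < p × u ≤ p × 2 * (n * (u * u)) ≤ p * p)
  union-sparse n m a K u n²≤am 2w≤n 8w²≤n u≤Kn = p , p+u≡m , p>0 , u≤p , 2nu²≤p²
    where
    open ≤-Reasoning
    p : ℕ
    p = m ∸ u
    2u≤m : u + u ≤ m
    2u≤m = *-cancelˡ-≤ a (begin
      a * (u + u)              ≤⟨ *-monoʳ-≤ a (+-mono-≤ u≤Kn u≤Kn) ⟩
      a * (K * n + K * n)      ≡⟨ lemma a K n ⟩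
      2 * (a * K) * n          ≤⟨ *-monoˡ-≤ n 2w≤n ⟩
      n * n                    ≤⟨ n²≤am ⟩
      a * m                    ∎)
      where
      lemma : ∀ a K n → a * (K * n + K * n) ≡ 2 * (a * K) * n
      lemma = solve-∀
    p+u≡m : p + u ≡ m
    p+u≡m = m∸n+n≡m (≤-trans (m≤m+n u u) 2u≤m)
    u≤p : u ≤ p
    u≤p = +-cancelʳ-≤ u u p (≤-trans 2u≤m (≤-reflexive (sym p+u≡m)))
    m≤2p : m ≤ 2 * p
    m≤2p = begin
      m             ≡⟨ p+u≡m ⟨
      p + u         ≤⟨ +-monoʳ-≤ p u≤p ⟩
      p + p         ≡⟨ cong (p +_) (+-identityʳ p) ⟨
      2 * p         ∎
    p>0 : 0 < p
    p>0 = n≢0⇒n>0 λ p≡0 → <⇒≱ (ℕ.>-nonZero⁻¹ (n * n) {{m*n≢0 n n}})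
      (≤-trans n²≤am (≤-trans (*-monoʳ-≤ a (≤-trans m≤2p (≤-reflexive (cong (2 *_) p≡0)))) (≤-reflexive (*-zeroʳ a))))
    2nu²≤p² : 2 * (n * (u * u)) ≤ p * p
    2nu²≤p² = *-cancelˡ-≤ (4 * (a * a)) {{m*n≢0 4 (a * a) {{it}} {{m*n≢0 a a}}}} (begin
      4 * (a * a) * (2 * (n * (u * u)))              ≤⟨ *-monoʳ-≤ (4 * (a * a)) (*-monoʳ-≤ 2 (*-monoʳ-≤ n (*-mono-≤ u≤Kn u≤Kn))) ⟩
      4 * (a * a) * (2 * (n * (K * n * (K * n))))    ≡⟨ lemma a K n ⟩
      8 * (a * K * (a * K)) * n * (n * n)            ≤⟨ *-monoˡ-≤ (n * n) (*-monoˡ-≤ n 8w²≤n) ⟩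
      n * n * (n * n)                                ≤⟨ *-mono-≤ n²≤am n²≤am ⟩
      a * m * (a * m)                                ≤⟨ *-mono-≤ (*-monoʳ-≤ a m≤2p) (*-monoʳ-≤ a m≤2p) ⟩
      a * (2 * p) * (a * (2 * p))                    ≡⟨ lemma′ a p ⟩
      4 * (a * a) * (p * p)                          ∎)
      where
      lemma : ∀ a K n → 4 * (a * a) * (2 * (n * (K * n * (K * n)))) ≡ 8 * (a * K * (a * K)) * n * (n * n)
      lemma = solve-∀
      lemma′ : ∀ a p → a * (2 * p) * (a * (2 * p)) ≡ 4 * (a * a) * (p * p)
      lemma′ = solve-∀

  -- `∑-choose-upper` bounds E[X | U ⊆ G] by 2 n! (m / N)ⁿ, and the lower bound on the first moment
  -- turns this into 2 c E[X].
  extension-bound : ∀ n m q c (U : BipGraph n) p → .{{NonZero n}} → .{{NonZero p}} →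
    q + m ≡ n * n → m ^ n * n ! * (n * n) choose q ≤ c * ((n * n) ^ n * totalMatchings n m) →
    p + ∣ U ∣ ≡ m → ∣ U ∣ ≤ p → 2 * (n * (∣ U ∣ * ∣ U ∣)) ≤ p * p →
    length (graphs n m) * ∑ (perfectMatchings n) (λ M → ∣ ∁ (U ∪ M) ∣ choose q)
      ≤ 2 * c * totalMatchings n m * ∣ ∁ U ∣ choose q
  extension-bound n m q c U p eq lower p+u≡m u≤p 2nu²≤p² = *-cancelˡ-≤ (N ^ n) {{m^n≢0 N n {{m*n≢0 n n}}}} (begin
    N ^ n * (length (graphs n m) * S)
      ≡⟨ cong (λ v → N ^ n * (v * S)) (length-graphs n m q eq) ⟩
    N ^ n * (N choose q * S)
      ≡⟨ lemma₁ (N ^ n) (N choose q) S ⟩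
    N choose q * (N ^ n * S)
      ≤⟨ *-monoʳ-≤ (N choose q) (∑-choose-upper p q U sum≡ u≤p 2nu²≤p²) ⟩
    N choose q * (2 * ((p + u) ^ n * n !) * g)
      ≡⟨ cong (λ v → N choose q * (2 * (v ^ n * n !) * g)) p+u≡m ⟩
    N choose q * (2 * (m ^ n * n !) * g)
      ≡⟨ lemma₂ (N choose q) (m ^ n * n !) g ⟩
    2 * (m ^ n * n ! * N choose q) * g
      ≤⟨ *-monoˡ-≤ g (*-monoʳ-≤ 2 lower) ⟩
    2 * (c * (N ^ n * totalMatchings n m)) * g
      ≡⟨ lemma₃ c (N ^ n) (totalMatchings n m) g ⟩
    N ^ n * (2 * c * totalMatchings n m * g)  ∎)
    where
    open ≤-Reasoning
    N u g S : ℕ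
    N = n * n
    u = ∣ U ∣
    g = ∣ ∁ U ∣ choose q
    S = ∑ (perfectMatchings n) (λ M → ∣ ∁ (U ∪ M) ∣ choose q)
    lemma₁ : ∀ a b s → a * (b * s) ≡ b * (a * s)
    lemma₁ = solve-∀
    lemma₂ : ∀ a b g → a * (2 * b * g) ≡ 2 * (b * a) * g
    lemma₂ = solve-∀
    lemma₃ : ∀ c t s g → 2 * (c * (t * s)) * g ≡ t * (2 * c * s * g)
    lemma₃ = solve-∀
    lemma₄ : ∀ p q u → p + q + u ≡ q + (p + u)
    lemma₄ = solve-∀
    sum≡ : p + q + u ≡ n * n
    sum≡ = trans (lemma₄ p q u) (trans (cong (q +_) p+u≡m) eq)

  -- With w = a K ≥ 1, both 2 w and 8 w² are at most 8 w³; these are the two forms in which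
  -- `union-sparse` takes the growth condition.
  cube-room : ∀ n a K → .{{NonZero a}} → .{{NonZero K}} → 8 * (a ^ 3 * K ^ 3) ≤ n →
    2 * (a * K) ≤ n × 8 * (a * K * (a * K)) ≤ n
  cube-room n a K 8w³≤n = ≤-trans 2w≤8w² 8w²≤n , 8w²≤n
    where
    open ≤-Reasoning
    w : ℕ
    w = a * K
    instance
      w≢0 : NonZero w
      w≢0 = m*n≢0 a K
    cube : ∀ a K → 8 * (a * K * (a * K) * (a * K)) ≡ 8 * (a * (a * (a * 1)) * (K * (K * (K * 1))))
    cube = solve-∀
    8w²≤n : 8 * (w * w) ≤ n
    8w²≤n = begin
      8 * (w * w)              ≤⟨ *-monoʳ-≤ 8 (m≤m*n (w * w) w) ⟩
      8 * (w * w * w)          ≡⟨ cube a K ⟩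
      8 * (a ^ 3 * K ^ 3)      ≤⟨ 8w³≤n ⟩
      n                        ∎
    2w≤8w² : 2 * w ≤ 8 * (w * w)
    2w≤8w² = *-mono-≤ {2} {8} (s≤s (s≤s z≤n)) (m≤m*n w w)

  moment-bound-⊥ : ∀ n m q c K → q + m ≡ n * n →
    (∀ U → ∣ U ∣ + n ≤ K * n →
      length (graphs n m) * ∑ (perfectMatchings n) (λ M → ∣ ∁ (U ∪ M) ∣ choose q) ≤ c * ∣ ∁ U ∣ choose q) →
    length (graphs n m) ^ K * ∑ (graphs n m) (λ G → #perfectMatchings n G ^ K) ≤ c ^ K * length (graphs n m)
  moment-bound-⊥ n m q c K eq step = begin
    b ^ K * ∑ (graphs n m) (λ G → #perfectMatchings n G ^ K)
      ≡⟨ cong (b ^ K *_) (moment-⊥ n m K) ⟨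
    b ^ K * moment n m ⊥ K
      ≤⟨ moment-bound n m (λ U → ∣ ∁ U ∣ choose q) b c K (moment-0 n m q eq) step
           K ⊥ (≤-reflexive (cong (_+ K * n) (∣⊥∣≡0 (n * n)))) ⟩
    c ^ K * ∣ ∁ (⊥ {n = n * n}) ∣ choose q
      ≡⟨ cong (λ v → c ^ K * v choose q) (∣∁⊥∣≡n (n * n)) ⟩
    c ^ K * (n * n) choose q
      ≡⟨ cong (c ^ K *_) (length-graphs n m q eq) ⟨
    c ^ K * b  ∎
    where
    open ≤-Reasoning
    b : ℕ
    b = length (graphs n m)

  -- Division by the (k + 1)-st power of the number of graphs yields E[X ^ k] ≤ (2 c E[X]) ^ k. The
  -- 2 comes from the extension by one matching, c from the first moment.
  moment-ratio : ∀ n m a c k r → .{{NonZero n}} → .{{NonZero a}} →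
    m ≤ n * n → n * n ≤ a * m → 2 * (a * k) ≤ n → 8 * (a * k * (a * k)) ≤ n →
    r + n ≡ m → m ^ n ≤ c * r ^ n →
    length (graphs n m) ^ k * ∑ (graphs n m) (λ G → #perfectMatchings n G ^ k)
      ≤ (2 * c * totalMatchings n m) ^ k * length (graphs n m)
  moment-ratio n m a c k r m≤n² n²≤am 2ak≤n 8[ak]²≤n r+n≡m m^n≤ =
    moment-bound-⊥ n m q (2 * c * totalMatchings n m) k q+m≡ step
    where
    q : ℕ
    q = n * n ∸ m
    q+m≡ : q + m ≡ n * n
    q+m≡ = m∸n+n≡m m≤n²
    lower : m ^ n * n ! * (n * n) choose q ≤ c * ((n * n) ^ n * totalMatchings n m)
    lower = totalMatchings-lower n m q c r q+m≡ r+n≡m m^n≤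
    step : ∀ U → ∣ U ∣ + n ≤ k * n →
      length (graphs n m) * ∑ (perfectMatchings n) (λ M → ∣ ∁ (U ∪ M) ∣ choose q)
        ≤ 2 * c * totalMatchings n m * ∣ ∁ U ∣ choose q
    step U h =
      let p , p+u≡m , p>0 , u≤p , 2nu²≤p² =
            union-sparse n m a k ∣ U ∣ n²≤am 2ak≤n 8[ak]²≤n (≤-trans (m≤m+n ∣ U ∣ n) h)
      in extension-bound n m q c U p {{it}} {{ℕ.>-nonZero p>0}} q+m≡ lower p+u≡m u≤p 2nu²≤p²

open import Defs
open import Algebra.Bundles using (CommutativeRing)
open import Data.Integer as ℤ using (+_; +[1+_]; -[1+_])
import Data.Integer.Properties as ℤ
open import Data.List using (List; []; _∷_; length)
open import Data.Nat as ℕ using (ℕ; zero; suc)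
import Data.Nat.Properties as ℕ
open import Data.Nat.Tactic.RingSolver using (solve-∀)
open import Data.Product using (∃; ∃-syntax; _,_; proj₁; proj₂)
open import Data.Rational
  using (ℚ; 0ℚ; 1ℚ; ½; mkℚ; _≤_; _<_; *<*; _*_; _-_; _/_; ↧ₙ_; toℚᵘ; Positive; NonNegative; nonNegative; NonZero; ≢-nonZero)
open import Data.Rational.Properties
import Data.Rational.Unnormalised as ℚᵘ
import Data.Rational.Unnormalised.Properties as ℚᵘ
open import Algebra.Properties.CommutativeSemiring.Exp
  (CommutativeRing.commutativeSemiring +-*-commutativeRing) using (^-distrib-*)
open import Function.Bundles using (Equivalence)
open import Relation.Binary.PropositionalEquality
open Counting using (∑; cube-room; power-loss; moment-ratio)

-- From counts to rational expectations

toℚᵘ-/ : ∀ a d → toℚᵘ (+ a / suc d) ℚᵘ.≃ ℚᵘ.mkℚᵘ (+ a) d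
toℚᵘ-/ a d = toℚᵘ-fromℚᵘ (ℚᵘ.mkℚᵘ (+ a) d)

/-*-cancel : ∀ a d .{{_ : ℕ.NonZero d}} → (+ a / d) * fromℕ d ≡ fromℕ a
/-*-cancel a (suc d) = toℚᵘ-injective (begin
  toℚᵘ ((+ a / suc d) * fromℕ (suc d))                ≈⟨ toℚᵘ-homo-* (+ a / suc d) (fromℕ (suc d)) ⟩
  toℚᵘ (+ a / suc d) ℚᵘ.* toℚᵘ (fromℕ (suc d))        ≈⟨ ℚᵘ.*-cong (toℚᵘ-/ a d) (toℚᵘ-/ (suc d) 0) ⟩
  ℚᵘ.mkℚᵘ (+ a) d ℚᵘ.* ℚᵘ.mkℚᵘ (+ suc d) 0            ≈⟨ ℚᵘ.*≡* (trans (ℤ.*-identityʳ _) (cong (λ v → + a ℤ.* + v) (sym (ℕ.*-identityʳ (suc d))))) ⟩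
  ℚᵘ.mkℚᵘ (+ a) 0                                     ≈⟨ toℚᵘ-/ a 0 ⟨
  toℚᵘ (fromℕ a)                                      ∎)
  where open ℚᵘ.≃-Reasoning

fromℕ-* : ∀ a b → fromℕ (a ℕ.* b) ≡ fromℕ a * fromℕ b
fromℕ-* a b = toℚᵘ-injective (begin
  toℚᵘ (fromℕ (a ℕ.* b))                     ≈⟨ toℚᵘ-/ (a ℕ.* b) 0 ⟩
  ℚᵘ.mkℚᵘ (+ (a ℕ.* b)) 0                    ≈⟨ ℚᵘ.*≡* (cong (ℤ._* + 1) (ℤ.pos-* a b)) ⟩
  ℚᵘ.mkℚᵘ (+ a) 0 ℚᵘ.* ℚᵘ.mkℚᵘ (+ b) 0       ≈⟨ ℚᵘ.*-cong (toℚᵘ-/ a 0) (toℚᵘ-/ b 0) ⟨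
  toℚᵘ (fromℕ a) ℚᵘ.* toℚᵘ (fromℕ b)         ≈⟨ toℚᵘ-homo-* (fromℕ a) (fromℕ b) ⟨
  toℚᵘ (fromℕ a * fromℕ b)                   ∎)
  where open ℚᵘ.≃-Reasoning

fromℕ-^ : ∀ a k → fromℕ (a ℕ.^ k) ≡ fromℕ a ^ k
fromℕ-^ a zero    = refl
fromℕ-^ a (suc k) = trans (fromℕ-* a (a ℕ.^ k)) (cong (fromℕ a *_) (fromℕ-^ a k))

fromℕ-mono-≤ : ∀ {a b} → a ℕ.≤ b → fromℕ a ≤ fromℕ b
fromℕ-mono-≤ {a} {b} a≤b = toℚᵘ-cancel-≤ (begin
  toℚᵘ (fromℕ a)      ≃⟨ toℚᵘ-/ a 0 ⟩
  ℚᵘ.mkℚᵘ (+ a) 0     ≤⟨ ℚᵘ.*≤* (ℤ.*-monoʳ-≤-nonNeg (+ 1) (ℤ.+≤+ a≤b)) ⟩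
  ℚᵘ.mkℚᵘ (+ b) 0     ≃⟨ toℚᵘ-/ b 0 ⟨
  toℚᵘ (fromℕ b)      ∎)
  where open ℚᵘ.≤-Reasoning

fromℕ-cancel-≤ : ∀ {a b} → fromℕ a ≤ fromℕ b → a ℕ.≤ b
fromℕ-cancel-≤ {a} {b} h = ℤ.drop‿+≤+ (ℤ.*-cancelʳ-≤-pos (+ a) (+ b) (+ 1) (ℚᵘ.drop-*≤* (begin
  ℚᵘ.mkℚᵘ (+ a) 0     ≃⟨ toℚᵘ-/ a 0 ⟨
  toℚᵘ (fromℕ a)      ≤⟨ toℚᵘ-mono-≤ h ⟩
  toℚᵘ (fromℕ b)      ≃⟨ toℚᵘ-/ b 0 ⟩
  ℚᵘ.mkℚᵘ (+ b) 0     ∎)))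
  where open ℚᵘ.≤-Reasoning

fromℕ-nonNeg : ∀ a → NonNegative (fromℕ a)
fromℕ-nonNeg a = nonNegative (fromℕ-mono-≤ {0} {a} ℕ.z≤n)

fromℕ-pos : ∀ a .{{_ : ℕ.NonZero a}} → Positive (fromℕ a)
fromℕ-pos a@(suc _) = nonNeg∧nonZero⇒pos (fromℕ a) {{fromℕ-nonNeg a}} {{ℚ≢0}}
  where
  ℚ≢0 : NonZero (fromℕ a)
  ℚ≢0 = ≢-nonZero λ eq → ℕ.<⇒≱ (ℕ.s≤s ℕ.z≤n) (fromℕ-cancel-≤ {a} {0} (≤-reflexive eq))

𝔼-power-≤ : {A : Set} (xs : List A) (f : A → ℕ) (c k : ℕ) .{{_ : ℕ.NonZero k}} →
  length xs ℕ.^ k ℕ.* ∑ xs (λ x → f x ℕ.^ k) ℕ.≤ (c ℕ.* ∑ xs f) ℕ.^ k ℕ.* length xs →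
  𝔼 xs (λ x → f x ℕ.^ k) ≤ fromℕ c ^ k * 𝔼 xs f ^ k
-- On the empty list both expectations take the default value 0, and the right side vanishes because
-- k is positive.
𝔼-power-≤ []            f c k@(suc j) h = ≤-reflexive (sym (trans (cong (fromℕ c ^ k *_) (*-zeroˡ (0ℚ ^ j))) (*-zeroʳ (fromℕ c ^ k))))
𝔼-power-≤ xs@(_ ∷ _) f c k h = *-cancelʳ-≤-pos (fromℕ (g ℕ.^ k ℕ.* g)) {{fromℕ-pos (g ℕ.^ k ℕ.* g) {{ℕ.m*n≢0 (g ℕ.^ k) g {{ℕ.m^n≢0 g k}}}}}} (begin
  x * fromℕ (g ℕ.^ k ℕ.* g)                       ≡⟨ cong (x *_) (trans (cong fromℕ (ℕ.*-comm (g ℕ.^ k) g)) (fromℕ-* g (g ℕ.^ k))) ⟩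
  x * (fromℕ g * fromℕ (g ℕ.^ k))                 ≡⟨ *-assoc x (fromℕ g) _ ⟨
  x * fromℕ g * fromℕ (g ℕ.^ k)                   ≡⟨ cong (_* fromℕ (g ℕ.^ k)) (/-*-cancel Sₖ g) ⟩
  fromℕ Sₖ * fromℕ (g ℕ.^ k)                      ≡⟨ trans (sym (fromℕ-* Sₖ (g ℕ.^ k))) (cong fromℕ (ℕ.*-comm Sₖ (g ℕ.^ k))) ⟩
  fromℕ (g ℕ.^ k ℕ.* Sₖ)                          ≤⟨ fromℕ-mono-≤ h ⟩
  fromℕ ((c ℕ.* S) ℕ.^ k ℕ.* g)                   ≡⟨ trans (fromℕ-* ((c ℕ.* S) ℕ.^ k) g) (cong (_* fromℕ g) (trans (fromℕ-^ (c ℕ.* S) k) (cong (_^ k) (fromℕ-* c S)))) ⟩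
  (fromℕ c * fromℕ S) ^ k * fromℕ g               ≡⟨ cong (λ v → (fromℕ c * v) ^ k * fromℕ g) (/-*-cancel S g) ⟨
  (fromℕ c * (y * fromℕ g)) ^ k * fromℕ g         ≡⟨ cong (_* fromℕ g) (trans (^-distrib-* (fromℕ c) (y * fromℕ g) k) (cong (fromℕ c ^ k *_) (^-distrib-* y (fromℕ g) k))) ⟩
  fromℕ c ^ k * (y ^ k * fromℕ g ^ k) * fromℕ g   ≡⟨ cong (_* fromℕ g) (*-assoc (fromℕ c ^ k) (y ^ k) (fromℕ g ^ k)) ⟨
  fromℕ c ^ k * y ^ k * fromℕ g ^ k * fromℕ g     ≡⟨ *-assoc (fromℕ c ^ k * y ^ k) (fromℕ g ^ k) (fromℕ g) ⟩
  fromℕ c ^ k * y ^ k * (fromℕ g ^ k * fromℕ g)   ≡⟨ cong (fromℕ c ^ k * y ^ k *_) (trans (fromℕ-* (g ℕ.^ k) g) (cong (_* fromℕ g) (fromℕ-^ g k))) ⟨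
  fromℕ c ^ k * y ^ k * fromℕ (g ℕ.^ k ℕ.* g)     ∎)
  where
  open ≤-Reasoning
  g Sₖ S : ℕ
  g  = length xs
  Sₖ = ∑ xs (λ x → f x ℕ.^ k)
  S  = ∑ xs f
  x y : ℚ
  x = + Sₖ / g
  y = + S / g

-- The density and growth hypotheses in ℕ

-- A positive rational has numerator at least 1, so r is at least the inverse of its denominator,
-- which thus serves as the integer a with n² ≤ a m.
density-lower : ∀ r → 0ℚ < r → ∀ N m → r * fromℕ N ≤ fromℕ m → N ℕ.≤ ↧ₙ r ℕ.* m
density-lower r@(mkℚ +[1+ s ] d _) 0<r N m h = ℕ.≤-trans (ℕ.m≤n*m N (suc s)) (fromℕ-cancel-≤ (begin
  fromℕ (suc s ℕ.* N)                ≡⟨ fromℕ-* (suc s) N ⟩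
  fromℕ (suc s) * fromℕ N            ≡⟨ cong (_* fromℕ N) (trans (cong (_* fromℕ (suc d)) (sym (↥p/↧p≡p r))) (/-*-cancel (suc s) (suc d))) ⟨
  r * fromℕ (suc d) * fromℕ N        ≡⟨ cong (_* fromℕ N) (*-comm r (fromℕ (suc d))) ⟩
  fromℕ (suc d) * r * fromℕ N        ≡⟨ *-assoc (fromℕ (suc d)) r (fromℕ N) ⟩
  fromℕ (suc d) * (r * fromℕ N)      ≤⟨ *-monoˡ-≤-nonNeg (fromℕ (suc d)) {{fromℕ-nonNeg (suc d)}} h ⟩
  fromℕ (suc d) * fromℕ m            ≡⟨ fromℕ-* (suc d) m ⟨
  fromℕ (suc d ℕ.* m)                ∎))
  where open ≤-Reasoning
density-lower (mkℚ (+ 0) d _) (*<* 0<0) N m h with () ← ℤ.<-irrefl refl 0<0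
density-lower (mkℚ -[1+ s ] d _) (*<* ()) N m h

density-upper : ∀ r → 0ℚ < r → ∀ N m → fromℕ m ≤ (1ℚ - r) * fromℕ N → m ℕ.≤ N
density-upper r 0<r N m h = fromℕ-cancel-≤ (begin
  fromℕ m                  ≤⟨ h ⟩
  (1ℚ - r) * fromℕ N       ≤⟨ *-monoʳ-≤-nonNeg (fromℕ N) {{fromℕ-nonNeg N}} (+-monoʳ-≤ 1ℚ (neg-antimono-≤ (<⇒≤ 0<r))) ⟩
  1ℚ * fromℕ N             ≡⟨ *-identityˡ (fromℕ N) ⟩
  fromℕ N                  ∎)
  where open ≤-Reasoning

-- The choice ε = 1 / (2 a) gives ε⁻³ = 8 a³, the factor in the hypothesis of `cube-room`.
cube-bound : ∀ a k n .{{_ : ℕ.NonZero a}} → let instance _ = ℕ.m*n≢0 2 a in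
  fromℕ k ^ 3 ≤ (+ 1 / (2 ℕ.* a)) ^ 3 * fromℕ n → 8 ℕ.* (a ℕ.^ 3 ℕ.* k ℕ.^ 3) ℕ.≤ n
cube-bound a k n h = ℕ.≤-trans (ℕ.≤-reflexive (lemma a k)) (fromℕ-cancel-≤ (begin
  fromℕ ((2 ℕ.* a) ℕ.^ 3 ℕ.* k ℕ.^ 3)      ≡⟨ fromℕ-* ((2 ℕ.* a) ℕ.^ 3) (k ℕ.^ 3) ⟩
  fromℕ ((2 ℕ.* a) ℕ.^ 3) * fromℕ (k ℕ.^ 3)  ≡⟨ cong₂ _*_ (fromℕ-^ (2 ℕ.* a) 3) (fromℕ-^ k 3) ⟩
  b ^ 3 * fromℕ k ^ 3                      ≤⟨ *-monoˡ-≤-nonNeg (b ^ 3) {{subst NonNegative (fromℕ-^ (2 ℕ.* a) 3) (fromℕ-nonNeg ((2 ℕ.* a) ℕ.^ 3))}} h ⟩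
  b ^ 3 * (ε ^ 3 * fromℕ n)                ≡⟨ *-assoc (b ^ 3) (ε ^ 3) (fromℕ n) ⟨
  b ^ 3 * ε ^ 3 * fromℕ n                  ≡⟨ cong (_* fromℕ n) (^-distrib-* b ε 3) ⟨
  (b * ε) ^ 3 * fromℕ n                    ≡⟨ cong (λ v → v ^ 3 * fromℕ n) (trans (*-comm b ε) (/-*-cancel 1 (2 ℕ.* a))) ⟩
  1ℚ ^ 3 * fromℕ n                         ≡⟨ *-identityˡ (fromℕ n) ⟩
  fromℕ n                                  ∎))
  where
  open ≤-Reasoning
  instance
    2a≢0 : ℕ.NonZero (2 ℕ.* a)
    2a≢0 = ℕ.m*n≢0 2 a
  b ε : ℚ
  b = fromℕ (2 ℕ.* a)
  ε = + 1 / (2 ℕ.* a)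
  lemma : ∀ a k → 8 ℕ.* (a ℕ.* (a ℕ.* (a ℕ.* 1)) ℕ.* (k ℕ.* (k ℕ.* (k ℕ.* 1))))
    ≡ (2 ℕ.* a) ℕ.* ((2 ℕ.* a) ℕ.* ((2 ℕ.* a) ℕ.* 1)) ℕ.* (k ℕ.* (k ℕ.* (k ℕ.* 1)))
  lemma = solve-∀

lemma2p7 : (δ : ℝ) → 0ℚ <ʳ δ → δ ʳ< ½ →
    ∃ λ (C : ℚ) → ((k : ℕ → ℕ) → (∀ n → 0 ℕ.< k n) → IsLittleOCbrt k →
    ∃[ N ] (∀ n → N ℕ.≤ n → ∀ m → DensityRange δ n m →
    𝔼B n m (λ G → #perfectMatchings n G ℕ.^ k n)
    ≤ C ^ k n * 𝔼B n m (#perfectMatchings n) ^ k n))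
-- Roundedness of the lower cut supplies a rational r with 0 < r < δ. Its denominator a determines
-- the constant 2 c, with c = 2 ^ (4 a), before any sequence k is given.
lemma2p7 δ 0<δ _ with r , 0<r , r<δ ← Equivalence.to (ℝ.lower-rounded δ 0ℚ) 0<δ = fromℕ (2 ℕ.* c) , bound
  where
  a c : ℕ
  a = ↧ₙ r
  c = 2 ℕ.^ (4 ℕ.* a)
  instance
    2a≢0 : ℕ.NonZero (2 ℕ.* a)
    2a≢0 = ℕ.m*n≢0 2 a
  ε : ℚ
  ε = + 1 / (2 ℕ.* a)
  0<ε : 0ℚ < ε
  0<ε = *-cancelʳ-<-nonNeg (fromℕ (2 ℕ.* a)) {{fromℕ-nonNeg (2 ℕ.* a)}}
    (subst₂ _<_ (sym (*-zeroˡ (fromℕ (2 ℕ.* a)))) (sym (/-*-cancel 1 (2 ℕ.* a))) (positive⁻¹ 1ℚ))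
  bound : (k : ℕ → ℕ) → (∀ n → 0 ℕ.< k n) → IsLittleOCbrt k →
    ∃[ N ] (∀ n → N ℕ.≤ n → ∀ m → DensityRange δ n m →
    𝔼B n m (λ G → #perfectMatchings n G ℕ.^ k n)
    ≤ fromℕ (2 ℕ.* c) ^ k n * 𝔼B n m (#perfectMatchings n) ^ k n)
  bound k k>0 k≪ with N , k≤ ← k≪ ε 0<ε = N , λ n N≤n m dense →
    let instance
          kn≢0 : ℕ.NonZero (k n)
          kn≢0 = ℕ.>-nonZero (k>0 n)
        8a³k³≤n = cube-bound a (k n) n (k≤ n N≤n)
        2ak≤n , 8[ak]²≤n = cube-room n a (k n) 8a³k³≤n
        -- As k n is positive, the growth condition itself forces n to be large, so the threshold N
        -- for ε serves for the whole bound.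
        2a≤n = ℕ.≤-trans (ℕ.*-monoʳ-≤ 2 (ℕ.m≤m*n a (k n))) 2ak≤n
        instance
          n≢0 : ℕ.NonZero n
          n≢0 = ℕ.>-nonZero (ℕ.≤-trans (ℕ.>-nonZero⁻¹ (2 ℕ.* a)) 2a≤n)
        n²≤am = density-lower r 0<r (n ℕ.* n) m (dense r r<δ .proj₁)
        s , s+n≡m , m^n≤ = power-loss n m a n²≤am 2a≤n
    in 𝔼-power-≤ (graphs n m) (#perfectMatchings n) (2 ℕ.* c) (k n)
      (moment-ratio n m a c (k n) s (density-upper r 0<r (n ℕ.* n) m (dense r r<δ .proj₂))
        n²≤am 2ak≤n 8[ak]²≤n s+n≡m m^n≤)
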